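{- Let $n,m,\ell$ be integers with $n-1\ge m\ge \ell\ge 0$. Then $$\mathcal Y_n\big(2^{\{m-\ell\}},1^{\{\ell\}}\big)+n\sum_{j=0}^{n-m-2}\mathcal Y_n\big(3^{\{m-\ell+1+j\}},2^{\{\ell-1-j\}},1^{\{n-m-2-j\}}\big)=\frac{1}{n(m+1)}\left(\binom{n-1}{m}+(-1)^m\binom{n-1}{2m+1}\right)\binom{n}{\ell}.$$
   Context: Let $\zeta_n=e^{2\pi\sqrt{ -1}/n}$. For positive integers $s_1,\dots,s_m$, define $\mathfrak Z_n(s_1,\dots,s_m):=\sum_{1\le i_1<\cdots<i_m\le n-1}\prod_{k=1}^{m}(1-\zeta_n^{i_k})^{ -s_k}$ (equal to $1$ if $m=0$ and to $0$ if $m>n-1$). Define $\mathcal Y_n(s_1,\dots,s_m):=\sum_{\sigma}\mathfrak Z_n(\sigma)$, where $\sigma$ runs over all distinct rearrangements of $(s_1,\dots,s_m)$; $\mathcal Y_n$ of the empty sequence is $1$. Notation: $a^{\{k\}}$ denotes the block $a,\dots,a$ of length $k$; any $\mathcal Y_n$ term in which some block has negative length is interpreted as $0$. Binomial coefficients $\binom{a}{b}$ are $0$ when $b<0$ or $b>a\ge0$. -}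

module Defs where

open import Algebra.Apartness.Bundles using (HeytingField; HeytingCommutativeRing)
open import Algebra.Bundles using (CommutativeRing)
import Algebra.Properties.Monoid.Mult
import Algebra.Properties.Monoid.Sum
import Algebra.Properties.Semiring.Exp
open import Data.Fin.Base using (Fin; toℕ)
open import Data.Fin.Properties using (toℕ<n)
open import Data.Integer.Base using (ℤ; +_; -[1+_])
open import Data.List.Base
  using (List; []; _∷_; _++_; map; concatMap; foldr; zipWith; length; replicate; allFin; deduplicate)
open import Data.List.Properties using (≡-dec)
open import Data.Maybe.Base using (Maybe; just; nothing; maybe′)
import Data.Maybe.Base as Maybe
open import Data.Nat.Base using (ℕ; zero; suc; _<_; _∸_; NonZero; z≤n; s≤s)
open import Data.Nat.Properties using (_≟_)
open import Data.Product.Base using (proj₁)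
open import Level using (_⊔_)

-- The subsequences of length m, listed by position.  Applied to an increasing
-- list without repetitions these are exactly its strictly increasing m-tuples.
subsequences : ∀ {a} {A : Set a} → ℕ → List A → List (List A)
subsequences zero    xs       = [] ∷ []
subsequences (suc m) []       = []
subsequences (suc m) (x ∷ xs) = map (x ∷_) (subsequences m xs) ++ subsequences (suc m) xs

insertions : ∀ {a} {A : Set a} → A → List A → List (List A)
insertions x []       = (x ∷ []) ∷ []
insertions x (y ∷ ys) = (x ∷ y ∷ ys) ∷ map (y ∷_) (insertions x ys)

permutations : ∀ {a} {A : Set a} → List A → List (List A)
permutations []       = [] ∷ []
permutations (x ∷ xs) = concatMap (insertions x) (permutations xs)

-- Each distinct rearrangement is listed once, even if s has repeated entries.
rearrangements : List ℕ → List (List ℕ)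
rearrangements s = deduplicate (≡-dec _≟_) (permutations s)

-- A block a , … , a whose length is an integer, possibly negative.
record Block : Set where
  constructor _^[_]
  field
    entry : ℕ
    len   : ℤ

infix 8 _^[_]

-- The sequence described by consecutive blocks; nothing if some length is negative.
expand : List Block → Maybe (List ℕ)
expand []                      = just []
expand (a ^[ + k ]      ∷ bs)  = Maybe.map (replicate k a ++_) (expand bs)
expand (a ^[ -[1+ k ] ] ∷ bs)  = nothing

module RootOfUnitySums {c ℓ₁ ℓ₂} (K : HeytingField c ℓ₁ ℓ₂) where

  open HeytingField K
  open HeytingCommutativeRing heytingCommutativeRing using (commutativeRing)
  open CommutativeRing commutativeRing using (semiring; +-monoid)
  open Algebra.Properties.Semiring.Exp semiring public using (_^_)
  open Algebra.Properties.Monoid.Mult +-monoid public using (_×_)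
  open Algebra.Properties.Monoid.Sum +-monoid public using (sum; sum-syntax)

  sumList : List Carrier → Carrier
  sumList = foldr _+_ 0#

  productList : List Carrier → Carrier
  productList = foldr _*_ 1#

  fromℕ : ℕ → Carrier
  fromℕ k = k × 1#

  CharacteristicZero : Set ℓ₂
  CharacteristicZero = ∀ k → .⦃ NonZero k ⦄ → fromℕ k # 0#

  -- The inverse provided is that of fromℕ k - 0#.
  recipℕ : CharacteristicZero → (k : ℕ) → .⦃ NonZero k ⦄ → Carrier
  recipℕ char0 k = proj₁ (#⇒invertible (char0 k))

  -- The complex numbers are not available, so ζ_n = exp (2πi/n) is replaced by
  -- an arbitrary primitive n-th root of unity ζ in K; for K = ℂ it is one.
  -- Apartness, rather than mere inequality, is what makes 1 - ζ ^ i invertible.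
  record IsPrimitiveRoot (n : ℕ) (ζ : Carrier) : Set (ℓ₁ ⊔ ℓ₂) where
    field
      ζ^n≈1       : ζ ^ n ≈ 1#
      1-apart-ζ^i : ∀ {i} → 0 < i → i < n → 1# # ζ ^ i

  module _ {n : ℕ} {ζ : Carrier} (prim : IsPrimitiveRoot n ζ) where

    open IsPrimitiveRoot prim

    private
      index<n : ∀ {n} (i : Fin (n ∸ 1)) → suc (toℕ i) < n
      index<n {suc n} i = s≤s (toℕ<n i)

    -- Indices 1 ≤ i ≤ n - 1 are represented by Fin (n ∸ 1), shifted by one:
    -- recip i is the inverse of 1# - ζ ^ suc (toℕ i).
    recip : Fin (n ∸ 1) → Carrier
    recip i = proj₁ (#⇒invertible (1-apart-ζ^i (s≤s z≤n) (index<n i)))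

    ℨ : List ℕ → Carrier
    ℨ s = sumList (map (λ is → productList (zipWith (λ i sₖ → recip i ^ sₖ) is s))
                       (subsequences (length s) (allFin (n ∸ 1))))

    𝒴-list : List ℕ → Carrier
    𝒴-list s = sumList (map ℨ (rearrangements s))

    𝒴 : List Block → Carrier
    𝒴 bs = maybe′ 𝒴-list 0# (expand bs)

{-# OPTIONS --safe #-}
module Submission where

-- Put N = n - 1, xᵢ = 1/(1 - ζⁱ) and yᵢ = 1 - ζⁱ for 1 ≤ i ≤ N.  The sum 𝒴 over all rearrangements
-- is a monomial symmetric function of the xᵢ.  Since n ∏ xᵢ = 1, a factor n lowers every exponent
-- by one, so the left-hand side collects the monomials with exponents 2, 1, 0, -1 in which m
-- exponents are 2 or 1 and ℓ exponents are 1 or -1.  This is the coefficient of sᵐ tˡ in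
--   ∏ (s xᵢ² + s t xᵢ + 1 + t/xᵢ) = ∏ (1 + s xᵢ²) · ∏ (1 + t yᵢ),
-- that is, e_m(x²) e_ℓ(y).  The elementary symmetric functions of all n-th roots of unity vanish in
-- degrees 1, …, n - 1, whence e_k(y) = C(n, k) and n e_k(x) = C(n, k + 1).  Finally e_m(x²) is read
-- off from ∏ (1 + xᵢ t)(1 - xᵢ t) = ∏ (1 - xᵢ² t²).

open import Defs
open import Algebra.Apartness.Bundles using (HeytingCommutativeRing; HeytingField)
open import Algebra.Bundles using (CommutativeRing; Semiring)
open import Data.Empty using (⊥)
open import Data.Fin.Base using (Fin; zero; suc; toℕ; inject₁)
import Data.Fin.Base as Fin
open import Data.Fin.Properties using (toℕ<n; toℕ-fromℕ; toℕ-inject₁)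
open import Data.Integer.Base using (+_)
import Data.Integer.Base as ℤ
import Data.Integer.Properties as ℤ
open import Data.List.Base
  using (List; []; _∷_; _++_; allFin; length; map; replicate; tabulate; zipWith)
open import Data.List.Membership.Propositional using (_∈_; find; lose)
open import Data.List.Membership.Propositional.Properties
  using (∈-++⁺ˡ; ∈-++⁺ʳ; ∈-++⁻; ∈-map⁺; ∈-map⁻; ∈-∃++; ∈-concatMap⁺; ∈-concatMap⁻;
         ∈-deduplicate⁺; ∈-deduplicate⁻)
open import Data.List.Membership.Propositional.Properties.WithK using (unique∧set⇒bag)
open import Data.List.Properties using (≡-dec; ∷-injectiveˡ; ∷-injectiveʳ)
open import Data.List.Relation.Binary.BagAndSetEquality using (∼bag⇒↭)
open import Data.List.Relation.Binary.Permutation.Propositional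
  using (_↭_; ↭-refl; ↭-sym; ↭-trans; prep; swap)
import Data.List.Relation.Binary.Permutation.Propositional as ↭
open import Data.List.Relation.Binary.Permutation.Propositional.Properties
  using (∈-resp-↭; drop-mid; shift; ↭-empty-inv; ↭-length)
open import Data.List.Relation.Unary.All using ([])
open import Data.List.Relation.Unary.AllPairs using ([]; _∷_)
open import Data.List.Relation.Unary.Any using (here; there)
open import Data.List.Relation.Unary.Unique.DecPropositional.Properties using (deduplicate-!)
open import Data.List.Relation.Unary.Unique.Propositional using (Unique)
open import Data.List.Relation.Unary.Unique.Propositional.Properties using (map⁺; ++⁺)
open import Data.Nat.Base using (ℕ; zero; suc; _≤_; _<_; _∸_; NonZero; z≤n; s≤s; z<s)
import Data.Nat.Base as ℕ
open import Data.Nat.Combinatorics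
  using (_C_; nCk≡nC[n∸k]; nC1≡n; nCk+nC[k+1]≡[n+1]C[k+1])
open import Data.Nat.Combinatorics.Specification using (k>n⇒nCk≡0)
open import Data.Nat.Properties using (m*n≢0)
import Data.Nat.Properties as ℕ
open import Data.Product.Base using (∃; _×_; _,_; proj₁; proj₂)
open import Data.Sum.Base using (_⊎_; inj₁; inj₂)
open import Function.Base using (_∘_; id)
open import Function.Bundles using (mk⇔)
open import Relation.Binary.PropositionalEquality.Core as ≡ using (_≡_; _≢_)
open import Relation.Nullary.Decidable.Core using (yes; no)
open import Relation.Nullary.Negation using (contradiction)

-- Negative exponents never occur below. Instead of lowering the terms that carry a factor n, the
-- first 𝒴, the only one without that factor, is multiplied by n ∏ xᵢ = 1, which raises its
-- exponents 2, 1, 0 to 3, 2, 1. The product to expand is then ∏ (1 + s xᵢ²)(xᵢ + t), from which ∏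
-- xᵢ is taken out at the end. If a, b, c, d variables have the exponents 3, 2, 1, 0, then a + b =
-- m, c + d = n - 1 - m and b + d = ℓ, so d alone determines the monomial. The first 𝒴 is d = 0 and
-- the summand j is d = j + 1. For d > ℓ no b exists, which is the case of a block of negative
-- length. The second binomial coefficient of the result has this origin: n e_k(x) = C(n, k + 1)
-- says that the generating function of the xᵢ is, up to a factor, (1 + t)ⁿ without its constant
-- term. The alternating sum of products of binomials that gives e_m(x²) is thus the one for (1 +
-- t)ⁿ(1 - t)ⁿ = (1 - t²)ⁿ, short of its two end terms.

+-suc₂ : ∀ {k} a b c → a ℕ.+ suc b ℕ.+ c ≡ suc k → a ℕ.+ b ℕ.+ c ≡ k
+-suc₂ a b c eq = ℕ.suc-injective (≡.trans (≡.sym (≡.cong (ℕ._+ c) (ℕ.+-suc a b))) eq)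

+-suc₁ : ∀ {k} a b c → a ℕ.+ b ℕ.+ suc c ≡ suc k → a ℕ.+ b ℕ.+ c ≡ k
+-suc₁ a b c eq = ℕ.suc-injective (≡.trans (≡.sym (ℕ.+-suc (a ℕ.+ b) c)) eq)

-- Distinct rearrangements of a sequence of 3s, 2s and 1s

∈-insertions⁺ : ∀ {a} {A : Set a} {x : A} as {bs} → as ++ x ∷ bs ∈ insertions x (as ++ bs)
∈-insertions⁺ []       {[]}     = here ≡.refl
∈-insertions⁺ []       {b ∷ bs} = here ≡.refl
∈-insertions⁺ (a ∷ as)          = there (∈-map⁺ (a ∷_) (∈-insertions⁺ as))

∈-insertions⁻ : ∀ {a} {A : Set a} {x : A} ys {r} → r ∈ insertions x ys → r ↭ x ∷ ys
∈-insertions⁻ []       (here ≡.refl) = ↭-refl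
∈-insertions⁻ (y ∷ ys) (here ≡.refl) = ↭-refl
∈-insertions⁻ {x = x} (y ∷ ys) (there r∈) with _ , r′∈ , ≡.refl ← ∈-map⁻ (y ∷_) r∈ =
  ↭-trans (prep y (∈-insertions⁻ ys r′∈)) (swap y x ↭-refl)

∈-permutations⁺ : ∀ {a} {A : Set a} (s : List A) {r} → r ↭ s → r ∈ permutations s
∈-permutations⁺ []       r↭s = here (↭-empty-inv r↭s)
∈-permutations⁺ (x ∷ xs) r↭s
  with as , bs , ≡.refl ← ∈-∃++ (∈-resp-↭ (↭-sym r↭s) (here ≡.refl)) =
  ∈-concatMap⁺ (insertions x)
    (lose (∈-permutations⁺ xs (drop-mid as [] r↭s)) (∈-insertions⁺ as))

∈-permutations⁻ : ∀ {a} {A : Set a} (s : List A) {r} → r ∈ permutations s → r ↭ s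
∈-permutations⁻ []       (here ≡.refl) = ↭-refl
∈-permutations⁻ (x ∷ xs) r∈
  with p , p∈ , r∈′ ← find (∈-concatMap⁻ (insertions x) {xs = permutations xs} r∈) =
  ↭-trans (∈-insertions⁻ p r∈′) (prep x (∈-permutations⁻ xs p∈))

-- The trailing `[]` makes this the very list that `expand` computes; for `a = 0` the block of 3s
-- disappears by computation, which covers the first 𝒴 as well.
blocks : ℕ → ℕ → ℕ → List ℕ
blocks a b c = replicate a 3 ++ replicate b 2 ++ replicate c 1 ++ []

length-blocks : ∀ a b c → length (blocks a b c) ≡ a ℕ.+ b ℕ.+ c
length-blocks (suc a) b       c       = ≡.cong suc (length-blocks a b c)
length-blocks zero    (suc b) c       = ≡.cong suc (length-blocks zero b c)
length-blocks zero    zero    (suc c) = ≡.cong suc (length-blocks zero zero c)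
length-blocks zero    zero    zero    = ≡.refl

blocks-suc₂ : ∀ a b c → blocks a (suc b) c ↭ 2 ∷ blocks a b c
blocks-suc₂ a b c = shift 2 (replicate a 3) (replicate b 2 ++ replicate c 1 ++ [])

blocks-suc₁ : ∀ a b c → blocks a b (suc c) ↭ 1 ∷ blocks a b c
blocks-suc₁ zero    zero    c = ↭-refl
blocks-suc₁ zero    (suc b) c = ↭-trans (prep 2 (blocks-suc₁ zero b c)) (swap 2 1 ↭-refl)
blocks-suc₁ (suc a) b       c = ↭-trans (prep 3 (blocks-suc₁ a b c)) (swap 3 1 ↭-refl)

-- A letter whose multiplicity is used up starts no word. Under summation this guard becomes the
-- shift `t·_`.
prepend : ℕ → (ℕ → List (List ℕ)) → ℕ → List (List ℕ)
prepend v L zero    = []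
prepend v L (suc k) = map (v ∷_) (L k)

-- Meaningful for a + b + c = k only.
words : ℕ → ℕ → ℕ → ℕ → List (List ℕ)
words zero    a b c = [] ∷ []
words (suc k) a b c = prepend 3 (λ a → words k a b c) a
                   ++ prepend 2 (λ b → words k a b c) b
                   ++ prepend 1 (λ c → words k a b c) c

∈-prepend⁻ : ∀ {v r} L k → r ∈ prepend v L k → ∃ λ k′ → ∃ λ r′ → k ≡ suc k′ × r ≡ v ∷ r′ × r′ ∈ L k′
∈-prepend⁻ {v} L (suc k) r∈ with r′ , r′∈ , eq ← ∈-map⁻ (v ∷_) r∈ = k , r′ , ≡.refl , eq , r′∈

∈-words⁻ : ∀ k a b c {r} → a ℕ.+ b ℕ.+ c ≡ k → r ∈ words k a b c → r ↭ blocks a b c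
∈-words⁻ zero zero zero zero _ (here ≡.refl) = ↭-refl
∈-words⁻ (suc k) a b c eq r∈ with ∈-++⁻ (prepend 3 (λ a → words k a b c) a) r∈
... | inj₁ r∈ with a , _ , ≡.refl , ≡.refl , r′∈ ← ∈-prepend⁻ _ a r∈ =
  prep 3 (∈-words⁻ k a b c (ℕ.suc-injective eq) r′∈)
... | inj₂ r∈ with ∈-++⁻ (prepend 2 (λ b → words k a b c) b) r∈
...   | inj₁ r∈ with b , _ , ≡.refl , ≡.refl , r′∈ ← ∈-prepend⁻ _ b r∈ =
  ↭-trans (prep 2 (∈-words⁻ k a b c (+-suc₂ a b c eq) r′∈)) (↭-sym (blocks-suc₂ a b c))
...   | inj₂ r∈ with c , _ , ≡.refl , ≡.refl , r′∈ ← ∈-prepend⁻ _ c r∈ =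
  ↭-trans (prep 1 (∈-words⁻ k a b c (+-suc₁ a b c eq) r′∈)) (↭-sym (blocks-suc₁ a b c))

∈-replicate⁻ : ∀ {v w : ℕ} k → v ∈ replicate k w → v ≡ w × ∃ λ k′ → k ≡ suc k′
∈-replicate⁻ (suc k) (here eq)  = eq , k , ≡.refl
∈-replicate⁻ (suc k) (there v∈) with eq , _ ← ∈-replicate⁻ k v∈ = eq , k , ≡.refl

∈-words⁺ : ∀ k a b c {r} → a ℕ.+ b ℕ.+ c ≡ k → r ↭ blocks a b c → r ∈ words k a b c
∈-words⁺ zero zero zero zero _ r↭ = here (↭-empty-inv r↭)
∈-words⁺ (suc k) a b c {[]} eq r↭ =
  contradiction (≡.trans (↭-length r↭) (≡.trans (length-blocks a b c) eq)) λ ()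
∈-words⁺ (suc k) a b c {v ∷ r} eq r↭ with ∈-++⁻ (replicate a 3) (∈-resp-↭ r↭ (here ≡.refl))
... | inj₁ v∈ with ≡.refl , a , ≡.refl ← ∈-replicate⁻ a v∈ =
  ∈-++⁺ˡ (∈-map⁺ (3 ∷_) (∈-words⁺ k a b c (ℕ.suc-injective eq) (drop-mid [] [] r↭)))
... | inj₂ v∈ with ∈-++⁻ (replicate b 2) v∈
...   | inj₁ v∈ with ≡.refl , b , ≡.refl ← ∈-replicate⁻ b v∈ =
  ∈-++⁺ʳ (prepend 3 _ a) (∈-++⁺ˡ (∈-map⁺ (2 ∷_)
    (∈-words⁺ k a b c (+-suc₂ a b c eq) (drop-mid [] [] (↭-trans r↭ (blocks-suc₂ a b c))))))
...   | inj₂ v∈ with ∈-++⁻ (replicate c 1) v∈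
...     | inj₁ v∈ with ≡.refl , c , ≡.refl ← ∈-replicate⁻ c v∈ =
  ∈-++⁺ʳ (prepend 3 _ a) (∈-++⁺ʳ (prepend 2 _ b) (∈-map⁺ (1 ∷_)
    (∈-words⁺ k a b c (+-suc₁ a b c eq) (drop-mid [] [] (↭-trans r↭ (blocks-suc₁ a b c))))))

prepend-unique : ∀ v L k → (∀ k → Unique (L k)) → Unique (prepend v L k)
prepend-unique v L zero    L! = []
prepend-unique v L (suc k) L! = map⁺ ∷-injectiveʳ (L! k)

prepend-disjoint : ∀ {v w r L₁ L₂} k₁ k₂ → v ≢ w → r ∈ prepend v L₁ k₁ → r ∈ prepend w L₂ k₂ → ⊥
prepend-disjoint k₁ k₂ v≢w r∈₁ r∈₂
  with _ , _ , _ , ≡.refl , _ ← ∈-prepend⁻ _ k₁ r∈₁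
  with _ , _ , _ , eq , _ ← ∈-prepend⁻ _ k₂ r∈₂ = contradiction (∷-injectiveˡ eq) v≢w

words-unique : ∀ k a b c → Unique (words k a b c)
words-unique zero    a b c = [] ∷ []
words-unique (suc k) a b c =
  ++⁺ (prepend-unique 3 _ a λ a → words-unique k a b c)
    (++⁺ (prepend-unique 2 _ b λ b → words-unique k a b c)
         (prepend-unique 1 _ c λ c → words-unique k a b c)
         λ { (r∈ , r∈′) → prepend-disjoint b c (λ ()) r∈ r∈′ })
    λ { (r∈ , r∈′) → 3∉ r∈ (∈-++⁻ (prepend 2 (λ b → words k a b c) b) r∈′) }
  where
  3∉ : ∀ {r} → r ∈ prepend 3 (λ a → words k a b c) a →
       r ∈ prepend 2 (λ b → words k a b c) b ⊎ r ∈ prepend 1 (λ c → words k a b c) c → ⊥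
  3∉ r∈ (inj₁ r∈′) = prepend-disjoint a b (λ ()) r∈ r∈′
  3∉ r∈ (inj₂ r∈′) = prepend-disjoint a c (λ ()) r∈ r∈′

-- Two lists without repetitions that have the same members agree as bags. This replaces
-- deduplication, which has no usable recursion, by the enumeration according to the first letter.
rearrangements-blocks : ∀ a b c → rearrangements (blocks a b c) ↭ words (a ℕ.+ b ℕ.+ c) a b c
rearrangements-blocks a b c = ∼bag⇒↭ (unique∧set⇒bag
  (deduplicate-! (≡-dec ℕ._≟_) (permutations (blocks a b c)))
  (words-unique (a ℕ.+ b ℕ.+ c) a b c)
  (mk⇔
    (λ r∈ → ∈-words⁺ _ a b c ≡.refl
      (∈-permutations⁻ (blocks a b c) (∈-deduplicate⁻ (≡-dec ℕ._≟_) (permutations (blocks a b c)) r∈)))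
    (λ r∈ → ∈-deduplicate⁺ (≡-dec ℕ._≟_)
      (∈-permutations⁺ (blocks a b c) (∈-words⁻ _ a b c ≡.refl r∈)))))

module SymmetricFunctions {c ℓ} (R : CommutativeRing c ℓ) where

  open CommutativeRing R hiding (zero)
  open import Algebra.Definitions.RawSemiring (Semiring.rawSemiring semiring) using (product)
  open import Algebra.Properties.Semiring.Exp semiring using (_^_; ^-congʳ)
  open import Algebra.Properties.Semiring.Mult semiring using () renaming (_×_ to _·_)
  import Algebra.Solver.Ring.NaturalCoefficients.Default commutativeSemiring as Solver
  open import Algebra.Properties.Monoid.Sum +-monoid using (sum-syntax)
  open import Relation.Binary.Reasoning.Setoid setoid
  open Solver using (_:+_; _:*_; _:=_; con)

  -- Elementary symmetric functions as coefficients of ∏ (1 + vᵢ t)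

  unit : ℕ → Carrier
  unit zero    = 1#
  unit (suc _) = 0#

  -- A sequence stands for its generating function in t.
  infix 9 t·_
  t·_ : (ℕ → Carrier) → ℕ → Carrier
  (t· f) zero    = 0#
  (t· f) (suc k) = f k

  t·-cong : ∀ {f g : ℕ → Carrier} → (∀ k → f k ≈ g k) → ∀ k → (t· f) k ≈ (t· g) k
  t·-cong f≈g zero    = refl
  t·-cong f≈g (suc k) = f≈g k

  -- The combination `f + a * g` is what multiplication by a factor 1 + a t produces; all linearity
  -- lemmas below have this shape.
  t·-linear : ∀ f a g k → (t· λ i → f i + a * g i) k ≈ (t· f) k + a * (t· g) k
  t·-linear f a g zero    = sym (trans (+-identityˡ _) (zeroʳ a))
  t·-linear f a g (suc k) = refl

  t·-*ˡ : ∀ a f k → (t· λ i → a * f i) k ≈ a * (t· f) k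
  t·-*ˡ a f zero    = sym (zeroʳ a)
  t·-*ˡ a f (suc k) = refl

  e : ∀ {n} → (Fin n → Carrier) → ℕ → Carrier
  e {zero}  v k = unit k
  e {suc n} v k = e (v ∘ suc) k + v zero * (t· e (v ∘ suc)) k

  e-cong : ∀ {n} {u v : Fin n → Carrier} → (∀ i → u i ≈ v i) → ∀ k → e u k ≈ e v k
  e-cong {zero}  u≈v k = refl
  e-cong {suc n} u≈v k =
    +-cong (e-cong (u≈v ∘ suc) k) (*-cong (u≈v zero) (t·-cong (e-cong (u≈v ∘ suc)) k))

  e-zero : ∀ {n} (v : Fin n → Carrier) → e v 0 ≈ 1#
  e-zero {zero}  v = refl
  e-zero {suc n} v = begin
    e (v ∘ suc) 0 + v zero * 0#  ≈⟨ +-cong (e-zero (v ∘ suc)) (zeroʳ _) ⟩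
    1# + 0#                      ≈⟨ +-identityʳ 1# ⟩
    1#                           ∎

  e-vanishes : ∀ {n} (v : Fin n → Carrier) {k} → n < k → e v k ≈ 0#
  e-vanishes {zero}  v {suc k} _ = refl
  e-vanishes {suc n} v {suc k} (s≤s n<k) = begin
    e (v ∘ suc) (suc k) + v zero * e (v ∘ suc) k
      ≈⟨ +-cong (e-vanishes (v ∘ suc) (ℕ.m<n⇒m<1+n n<k)) (*-congˡ (e-vanishes (v ∘ suc) n<k)) ⟩
    0# + v zero * 0#  ≈⟨ +-identityˡ _ ⟩
    v zero * 0#       ≈⟨ zeroʳ _ ⟩
    0#                ∎

  e-product : ∀ {n} (v : Fin n → Carrier) → e v n ≈ product v
  e-product {zero}  v = refl
  e-product {suc n} v = begin
    e (v ∘ suc) (suc n) + v zero * e (v ∘ suc) n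
      ≈⟨ +-cong (e-vanishes (v ∘ suc) (ℕ.n<1+n n)) (*-congˡ (e-product (v ∘ suc))) ⟩
    0# + v zero * product (v ∘ suc)  ≈⟨ +-identityˡ _ ⟩
    v zero * product (v ∘ suc)       ∎

  e-scale : ∀ {n} a (v : Fin n → Carrier) k → e (λ i → a * v i) k ≈ a ^ k * e v k
  e-scale {zero}  a v zero    = sym (*-identityˡ 1#)
  e-scale {zero}  a v (suc k) = sym (zeroʳ _)
  e-scale {suc n} a v zero    = begin
    e (λ i → a * v (suc i)) 0 + a * v zero * 0#
      ≈⟨ +-congʳ (e-scale a (v ∘ suc) 0) ⟩
    1# * e (v ∘ suc) 0 + a * v zero * 0#
      ≈⟨ Solver.solve 3 (λ a x p → con 1 :* p :+ a :* x :* con 0 := con 1 :* (p :+ x :* con 0))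
           refl a (v zero) (e (v ∘ suc) 0) ⟩
    1# * (e (v ∘ suc) 0 + v zero * 0#)  ∎
  e-scale {suc n} a v (suc k) = begin
    e (λ i → a * v (suc i)) (suc k) + a * v zero * e (λ i → a * v (suc i)) k
      ≈⟨ +-cong (e-scale a (v ∘ suc) (suc k)) (*-congˡ (e-scale a (v ∘ suc) k)) ⟩
    a * a ^ k * e (v ∘ suc) (suc k) + a * v zero * (a ^ k * e (v ∘ suc) k)
      ≈⟨ Solver.solve 5 (λ a b x p q → a :* b :* p :+ a :* x :* (b :* q) := a :* b :* (p :+ x :* q))
           refl a (a ^ k) (v zero) (e (v ∘ suc) (suc k)) (e (v ∘ suc) k) ⟩
    a * a ^ k * (e (v ∘ suc) (suc k) + v zero * e (v ∘ suc) k)  ∎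

  -- Takes out the last factor where the definition takes out the first; comparing the two is what
  -- makes a cyclic rotation visible.
  e-snoc : ∀ {n} (v : Fin (suc n) → Carrier) k →
           e v k ≈ e (v ∘ inject₁) k + v (Fin.fromℕ n) * (t· e (v ∘ inject₁)) k
  e-snoc {zero}  v k = refl
  e-snoc {suc n} v k = begin
    e (v ∘ suc) k + x * (t· e (v ∘ suc)) k
      ≈⟨ +-cong (e-snoc (v ∘ suc) k) (*-congˡ (trans (t·-cong (e-snoc (v ∘ suc)) k) (t·-linear u z (t· u) k))) ⟩
    (u k + z * (t· u) k) + x * ((t· u) k + z * (t· (t· u)) k)
      ≈⟨ Solver.solve 5 (λ x z p q r → (p :+ z :* q) :+ x :* (q :+ z :* r)
                                         := (p :+ x :* q) :+ z :* (q :+ x :* r))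
           refl x z (u k) ((t· u) k) ((t· (t· u)) k) ⟩
    (u k + x * (t· u) k) + z * ((t· u) k + x * (t· (t· u)) k)
      ≈⟨ +-congˡ (*-congˡ (t·-linear u x (t· u) k)) ⟨
    (u k + x * (t· u) k) + z * (t· λ i → u i + x * (t· u) i) k  ∎
    where
    x = v zero
    z = v (Fin.fromℕ (suc n))
    u = e (v ∘ inject₁ ∘ suc)

  -- Multiplication by ζ permutes s, sζ, …, sζⁿ⁻¹ cyclically.
  e-geometric : ∀ {ζ} n → ζ ^ n ≈ 1# → ∀ s k →
                ζ ^ k * e {n} (λ i → s * ζ ^ toℕ i) k ≈ e {n} (λ i → s * ζ ^ toℕ i) k
  e-geometric {ζ} zero    ζ^n≈1 s zero    = *-identityˡ 1#
  e-geometric {ζ} zero    ζ^n≈1 s (suc k) = zeroʳ _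
  e-geometric {ζ} (suc n) ζ^n≈1 s k = begin
    ζ ^ k * e v k       ≈⟨ e-scale ζ v k ⟨
    e w k               ≈⟨ e-snoc w k ⟩
    e (w ∘ inject₁) k + w (Fin.fromℕ n) * (t· e (w ∘ inject₁)) k
      ≈⟨ +-cong (e-cong init≈tail k) (*-cong last≈head (t·-cong (e-cong init≈tail) k)) ⟩
    e (v ∘ suc) k + v zero * (t· e (v ∘ suc)) k  ∎
    where
    v w : Fin (suc n) → Carrier
    v i = s * ζ ^ toℕ i
    w i = ζ * v i
    rotate : ∀ p → ζ * (s * p) ≈ s * (ζ * p)
    rotate p = Solver.solve 3 (λ z s p → z :* (s :* p) := s :* (z :* p)) refl ζ s p
    init≈tail : ∀ i → w (inject₁ i) ≈ v (suc i)
    init≈tail i = trans (rotate _) (*-congˡ (*-congˡ (^-congʳ ζ (toℕ-inject₁ i))))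
    last≈head : w (Fin.fromℕ n) ≈ v zero
    last≈head = trans (rotate _) (*-congˡ (trans (*-congˡ (^-congʳ ζ (toℕ-fromℕ n))) ζ^n≈1))

  -- The coefficients of (1 + t)ⁿ. As a case of `e` they inherit its lemmas, `e-squares` in
  -- particular; `binomial-fromℕ` identifies them with `_C_`.
  binomial : ℕ → ℕ → Carrier
  binomial n = e {n} (λ _ → 1#)

  -- The coefficients of ∑ⱼ f(j) tʲ (1 + t)ⁿ⁻ʲ, in Horner form.
  homogenise : ℕ → (ℕ → Carrier) → ℕ → Carrier
  homogenise zero    f k = f 0 * unit k
  homogenise (suc n) f k = f 0 * binomial (suc n) k + (t· homogenise n (f ∘ suc)) k

  homogenise-linear : ∀ n f a g k →
    homogenise n (λ i → f i + a * g i) k ≈ homogenise n f k + a * homogenise n g k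
  homogenise-linear zero f a g k =
    Solver.solve 4 (λ p a q u → (p :+ a :* q) :* u := p :* u :+ a :* (q :* u))
      refl (f 0) a (g 0) (unit k)
  homogenise-linear (suc n) f a g k = begin
    (f 0 + a * g 0) * b + (t· homogenise n (λ i → f (suc i) + a * g (suc i))) k
      ≈⟨ +-congˡ (trans (t·-cong (homogenise-linear n (f ∘ suc) a (g ∘ suc)) k)
                        (t·-linear F a G k)) ⟩
    (f 0 + a * g 0) * b + ((t· F) k + a * (t· G) k)
      ≈⟨ Solver.solve 6 (λ p a q b r s → (p :+ a :* q) :* b :+ (r :+ a :* s)
                                         := (p :* b :+ r) :+ a :* (q :* b :+ s))
           refl (f 0) a (g 0) b ((t· F) k) ((t· G) k) ⟩
    (f 0 * b + (t· F) k) + a * (g 0 * b + (t· G) k)  ∎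
    where
    b = binomial (suc n) k
    F = homogenise n (f ∘ suc)
    G = homogenise n (g ∘ suc)

  -- Passing from n to n + 1 multiplies every old term by 1 + t; the only new term is the one of
  -- index n + 1, which is assumed to vanish.
  homogenise-suc : ∀ n f → f (suc n) ≈ 0# → ∀ k →
    homogenise (suc n) f k ≈ homogenise n f k + (t· homogenise n f) k
  homogenise-suc zero f f1≈0 k = begin
    f 0 * (unit k + 1# * (t· unit) k) + (t· λ i → f 1 * unit i) k
      ≈⟨ +-congˡ (trans (t·-*ˡ (f 1) unit k) (trans (*-congʳ f1≈0) (zeroˡ _))) ⟩
    f 0 * (unit k + 1# * (t· unit) k) + 0#
      ≈⟨ Solver.solve 3 (λ p u s → p :* (u :+ con 1 :* s) :+ con 0 := p :* u :+ p :* s)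
           refl (f 0) (unit k) ((t· unit) k) ⟩
    f 0 * unit k + f 0 * (t· unit) k
      ≈⟨ +-congˡ (t·-*ˡ (f 0) unit k) ⟨
    f 0 * unit k + (t· λ i → f 0 * unit i) k  ∎
  homogenise-suc (suc n) f f≈0 k = begin
    f 0 * (b k + 1# * (t· b) k) + (t· homogenise (suc n) (f ∘ suc)) k
      ≈⟨ +-congˡ (t·-cong (λ i → trans (homogenise-suc n (f ∘ suc) f≈0 i) (+-congˡ (sym (*-identityˡ _)))) k) ⟩
    f 0 * (b k + 1# * (t· b) k) + (t· λ i → F i + 1# * (t· F) i) k
      ≈⟨ +-congˡ (t·-linear F 1# (t· F) k) ⟩
    f 0 * (b k + 1# * (t· b) k) + ((t· F) k + 1# * (t· (t· F)) k)
      ≈⟨ Solver.solve 5 (λ p b s q r → p :* (b :+ con 1 :* s) :+ (q :+ con 1 :* r)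
                                       := (p :* b :+ q) :+ (r :+ p :* s))
           refl (f 0) (b k) ((t· b) k) ((t· F) k) ((t· (t· F)) k) ⟩
    (f 0 * b k + (t· F) k) + ((t· (t· F)) k + f 0 * (t· b) k)
      ≈⟨ +-congˡ (trans (t·-cong (λ i → +-comm (f 0 * b i) ((t· F) i)) k) (t·-linear (t· F) (f 0) b k)) ⟨
    (f 0 * b k + (t· F) k) + (t· λ i → f 0 * b i + (t· F) i) k  ∎
    where
    b = binomial (suc n)
    F = homogenise n (f ∘ suc)

  homogenise-t· : ∀ n f k → homogenise (suc n) (t· f) k ≈ (t· homogenise n f) k
  homogenise-t· n f k = trans (+-congʳ (zeroˡ _)) (+-identityˡ _)

  -- Each factor 1 + (1 + vᵢ) t is (1 + t) + vᵢ t, so the product is the homogenised ∏ (1 + vᵢ s) at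
  -- the pair (1 + t, t).
  e-1+ : ∀ {n} (v : Fin n → Carrier) k → e (λ i → 1# + v i) k ≈ homogenise n (e v) k
  e-1+ {zero}  v k = sym (*-identityˡ _)
  e-1+ {suc n} v k = begin
    e (λ i → 1# + v (suc i)) k + (1# + x) * (t· e (λ i → 1# + v (suc i))) k
      ≈⟨ +-cong (e-1+ (v ∘ suc) k) (*-congˡ (t·-cong (e-1+ (v ∘ suc)) k)) ⟩
    F k + (1# + x) * (t· F) k
      ≈⟨ Solver.solve 3 (λ p x q → p :+ (con 1 :+ x) :* q := (p :+ q) :+ x :* q)
           refl (F k) x ((t· F) k) ⟩
    (F k + (t· F) k) + x * (t· F) k
      ≈⟨ +-cong (homogenise-suc n u (e-vanishes (v ∘ suc) (ℕ.n<1+n n)) k)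
                (*-congˡ (homogenise-t· n u k)) ⟨
    homogenise (suc n) u k + x * homogenise (suc n) (t· u) k
      ≈⟨ homogenise-linear (suc n) u x (t· u) k ⟨
    homogenise (suc n) (λ i → u i + x * (t· u) i) k  ∎
    where
    x = v zero
    u = e (v ∘ suc)
    F = homogenise n u

  homogenise-zero : ∀ n f k → (∀ j → j ≤ k → f j ≈ 0#) → homogenise n f k ≈ 0#
  homogenise-zero zero    f k f≈0 = trans (*-congʳ (f≈0 0 z≤n)) (zeroˡ _)
  homogenise-zero (suc n) f zero f≈0 =
    trans (+-identityʳ _) (trans (*-congʳ (f≈0 0 z≤n)) (zeroˡ _))
  homogenise-zero (suc n) f (suc k) f≈0 = begin
    f 0 * binomial (suc n) (suc k) + homogenise n (f ∘ suc) k
      ≈⟨ +-cong (*-congʳ (f≈0 0 z≤n)) (homogenise-zero n (f ∘ suc) k (λ j j≤k → f≈0 (suc j) (s≤s j≤k))) ⟩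
    0# * binomial (suc n) (suc k) + 0#  ≈⟨ +-identityʳ _ ⟩
    0# * binomial (suc n) (suc k)       ≈⟨ zeroˡ _ ⟩
    0#                                  ∎

  -- The term of index j starts in degree j, so only indices up to k reach degree k. The restriction
  -- to `j ≤ k` keeps away from the top degree, where the product of all roots of unity does not
  -- vanish.
  homogenise-one : ∀ n f k → f 0 ≈ 1# → (∀ j → 0 < j → j ≤ k → f j ≈ 0#) →
                   homogenise n f k ≈ binomial n k
  homogenise-one zero    f k f0≈1 f≈0 = trans (*-congʳ f0≈1) (*-identityˡ _)
  homogenise-one (suc n) f k f0≈1 f≈0 = begin
    f 0 * binomial (suc n) k + (t· homogenise n (f ∘ suc)) k
      ≈⟨ +-cong (trans (*-congʳ f0≈1) (*-identityˡ _)) (vanish k f≈0) ⟩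
    binomial (suc n) k + 0#  ≈⟨ +-identityʳ _ ⟩
    binomial (suc n) k       ∎
    where
    vanish : ∀ k → (∀ j → 0 < j → j ≤ k → f j ≈ 0#) → (t· homogenise n (f ∘ suc)) k ≈ 0#
    vanish zero    _   = refl
    vanish (suc k) f≈0 = homogenise-zero n (f ∘ suc) k (λ j j≤k → f≈0 (suc j) z<s (s≤s j≤k))

  -- Each factor 1 + yᵢ t equals yᵢ (xᵢ + t); taking out all yᵢ leaves the reversed polynomial of
  -- the xᵢ.
  e-reverse : ∀ {n} (x y : Fin n → Carrier) → (∀ i → x i * y i ≈ 1#) →
              ∀ j k → j ℕ.+ k ≡ n → e y j ≈ product y * e x k
  e-reverse {zero}  x y xy≈1 zero zero _ = sym (*-identityˡ 1#)
  e-reverse {suc n} x y xy≈1 j k j+k≡n = begin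
    e y′ j + y₀ * (t· e y′) j
      ≈⟨ +-cong (without j k j+k≡n) (*-congˡ (with₀ j k j+k≡n)) ⟩
    P * (t· e x′) k + y₀ * (P * e x′ k)
      ≈⟨ +-congʳ (trans (*-congʳ (xy≈1 zero)) (*-identityˡ _)) ⟨
    x₀ * y₀ * (P * (t· e x′) k) + y₀ * (P * e x′ k)
      ≈⟨ Solver.solve 5 (λ x y p q r → x :* y :* (p :* q) :+ y :* (p :* r)
                                       := y :* p :* (r :+ x :* q))
           refl x₀ y₀ P ((t· e x′) k) (e x′ k) ⟩
    y₀ * P * (e x′ k + x₀ * (t· e x′) k)  ∎
    where
    x₀ = x zero
    y₀ = y zero
    x′ = x ∘ suc
    y′ = y ∘ suc
    P = product y′
    without : ∀ j k → j ℕ.+ k ≡ suc n → e y′ j ≈ P * (t· e x′) k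
    without j zero    eq = trans (e-vanishes y′ (ℕ.≤-reflexive (≡.trans (≡.sym eq) (ℕ.+-identityʳ j)))) (sym (zeroʳ P))
    without j (suc k) eq =
      e-reverse x′ y′ (xy≈1 ∘ suc) j k (ℕ.suc-injective (≡.trans (≡.sym (ℕ.+-suc j k)) eq))
    with₀ : ∀ j k → j ℕ.+ k ≡ suc n → (t· e y′) j ≈ P * e x′ k
    with₀ zero    k ≡.refl = sym (trans (*-congˡ (e-vanishes x′ (ℕ.n<1+n n))) (zeroʳ P))
    with₀ (suc j) k eq = e-reverse x′ y′ (xy≈1 ∘ suc) j k (ℕ.suc-injective eq)

  -- Asks for equality at the predecessor of `k` only, for identities that hold only when the
  -- indices have a prescribed sum.
  t·-local : ∀ {f g : ℕ → Carrier} k → (∀ i → suc i ≡ k → f i ≈ g i) → (t· f) k ≈ (t· g) k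
  t·-local zero    f≈g = refl
  t·-local (suc k) f≈g = f≈g k ≡.refl

  t·-vanishes : ∀ {f : ℕ → Carrier} k → (∀ i → suc i ≡ k → f i ≈ 0#) → (t· f) k ≈ 0#
  t·-vanishes zero    f≈0 = refl
  t·-vanishes (suc k) f≈0 = f≈0 k ≡.refl

  -- Sums over i + j = k and Cauchy products

  antidiagonal : ℕ → (ℕ → ℕ → Carrier) → Carrier
  antidiagonal zero    F = F 0 0
  antidiagonal (suc k) F = F (suc k) 0 + antidiagonal k (λ i j → F i (suc j))

  antidiagonal-cong : ∀ k {F G} → (∀ i j → i ℕ.+ j ≡ k → F i j ≈ G i j) →
                      antidiagonal k F ≈ antidiagonal k G
  antidiagonal-cong zero    F≈G = F≈G 0 0 ≡.refl
  antidiagonal-cong (suc k) F≈G =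
    +-cong (F≈G (suc k) 0 (ℕ.+-identityʳ (suc k)))
           (antidiagonal-cong k λ i j eq → F≈G i (suc j) (≡.trans (ℕ.+-suc i j) (≡.cong suc eq)))

  antidiagonal-vanishes : ∀ k {F} → (∀ i j → i ℕ.+ j ≡ k → F i j ≈ 0#) → antidiagonal k F ≈ 0#
  antidiagonal-vanishes zero    F≈0 = F≈0 0 0 ≡.refl
  antidiagonal-vanishes (suc k) F≈0 = trans
    (+-cong (F≈0 (suc k) 0 (ℕ.+-identityʳ (suc k)))
            (antidiagonal-vanishes k λ i j eq → F≈0 i (suc j) (≡.trans (ℕ.+-suc i j) (≡.cong suc eq))))
    (+-identityˡ 0#)

  antidiagonal-linear : ∀ k F a G →
    antidiagonal k (λ i j → F i j + a * G i j) ≈ antidiagonal k F + a * antidiagonal k G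
  antidiagonal-linear zero    F a G = refl
  antidiagonal-linear (suc k) F a G = begin
    (F (suc k) 0 + a * G (suc k) 0) + antidiagonal k (λ i j → F i (suc j) + a * G i (suc j))
      ≈⟨ +-congˡ (antidiagonal-linear k (λ i j → F i (suc j)) a (λ i j → G i (suc j))) ⟩
    (F (suc k) 0 + a * G (suc k) 0) + (F′ + a * G′)
      ≈⟨ Solver.solve 5 (λ p a q r s → (p :+ a :* q) :+ (r :+ a :* s) := (p :+ r) :+ a :* (q :+ s))
           refl (F (suc k) 0) a (G (suc k) 0) F′ G′ ⟩
    (F (suc k) 0 + F′) + a * (G (suc k) 0 + G′)  ∎
    where
    F′ = antidiagonal k (λ i j → F i (suc j))
    G′ = antidiagonal k (λ i j → G i (suc j))

  -- A shift in one of the two indices is a shift of their sum `k`. The same holds for the left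
  -- index, while a shift in an independent parameter simply commutes with the sum.
  antidiagonal-t·ʳ : ∀ k F →
    antidiagonal k (λ i → t· (F i)) ≈ (t· λ k → antidiagonal k F) k
  antidiagonal-t·ʳ zero    F = refl
  antidiagonal-t·ʳ (suc k) F = +-identityˡ _

  antidiagonal-t·ˡ : ∀ k F →
    antidiagonal k (λ i j → (t· λ i → F i j) i) ≈ (t· λ k → antidiagonal k F) k
  antidiagonal-t·ˡ zero    F = refl
  antidiagonal-t·ˡ (suc zero)    F = +-identityʳ _
  antidiagonal-t·ˡ (suc (suc k)) F = +-congˡ (antidiagonal-t·ˡ (suc k) (λ i j → F i (suc j)))

  antidiagonal-t· : ∀ k (F : ℕ → ℕ → ℕ → Carrier) l →
    antidiagonal k (λ i j → (t· λ l → F l i j) l) ≈ (t· λ l → antidiagonal k (F l)) l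
  antidiagonal-t· k F zero    = antidiagonal-vanishes k (λ _ _ _ → refl)
  antidiagonal-t· k F (suc l) = refl

  antidiagonal-last : ∀ k F →
    antidiagonal (suc k) F ≈ antidiagonal k (λ i j → F (suc i) j) + F 0 (suc k)
  antidiagonal-last zero    F = refl
  antidiagonal-last (suc k) F = trans (+-congˡ (antidiagonal-last k (λ i j → F i (suc j)))) (sym (+-assoc _ _ _))

  -- Separates `j = 0` from the rest, exactly as the theorem separates its first 𝒴 from the sum.
  antidiagonal-sum : ∀ k F →
    antidiagonal k F ≈ F k 0 + ∑[ j < k ] F (k ∸ suc (toℕ j)) (suc (toℕ j))
  antidiagonal-sum zero    F = sym (+-identityʳ _)
  antidiagonal-sum (suc k) F = +-congˡ (antidiagonal-sum k (λ i j → F i (suc j)))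

  convolution : (ℕ → Carrier) → (ℕ → Carrier) → ℕ → Carrier
  convolution f g k = antidiagonal k (λ i j → f i * g j)

  -- A factor 1 + a t of one series is a factor of the product. Together with the version for the
  -- right argument this removes one variable from both series in `e-squares`.
  convolution-1+atˡ : ∀ f a g k →
    convolution (λ i → f i + a * (t· f) i) g k ≈ convolution f g k + a * (t· convolution f g) k
  convolution-1+atˡ f a g k = begin
    antidiagonal k (λ i j → (f i + a * (t· f) i) * g j)
      ≈⟨ antidiagonal-cong k (λ i j _ → distribute i j) ⟩
    antidiagonal k (λ i j → f i * g j + a * (t· λ i → f i * g j) i)
      ≈⟨ antidiagonal-linear k (λ i j → f i * g j) a (λ i j → (t· λ i → f i * g j) i) ⟩
    convolution f g k + a * antidiagonal k (λ i j → (t· λ i → f i * g j) i)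
      ≈⟨ +-congˡ (*-congˡ (antidiagonal-t·ˡ k (λ i j → f i * g j))) ⟩
    convolution f g k + a * (t· convolution f g) k  ∎
    where
    distribute : ∀ i j → (f i + a * (t· f) i) * g j ≈ f i * g j + a * (t· λ i → f i * g j) i
    distribute i j = begin
      (f i + a * (t· f) i) * g j
        ≈⟨ Solver.solve 4 (λ p a q r → (p :+ a :* q) :* r := p :* r :+ a :* (r :* q))
             refl (f i) a ((t· f) i) (g j) ⟩
      f i * g j + a * (g j * (t· f) i)
        ≈⟨ +-congˡ (*-congˡ (t·-*ˡ (g j) f i)) ⟨
      f i * g j + a * (t· λ i → g j * f i) i
        ≈⟨ +-congˡ (*-congˡ (t·-cong (λ i → *-comm (g j) (f i)) i)) ⟩
      f i * g j + a * (t· λ i → f i * g j) i  ∎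

  convolution-1+atʳ : ∀ f a g k →
    convolution f (λ j → g j + a * (t· g) j) k ≈ convolution f g k + a * (t· convolution f g) k
  convolution-1+atʳ f a g k = begin
    antidiagonal k (λ i j → f i * (g j + a * (t· g) j))
      ≈⟨ antidiagonal-cong k (λ i j _ → distribute i j) ⟩
    antidiagonal k (λ i j → f i * g j + a * (t· λ j → f i * g j) j)
      ≈⟨ antidiagonal-linear k (λ i j → f i * g j) a (λ i → t· λ j → f i * g j) ⟩
    convolution f g k + a * antidiagonal k (λ i → t· λ j → f i * g j)
      ≈⟨ +-congˡ (*-congˡ (antidiagonal-t·ʳ k (λ i j → f i * g j))) ⟩
    convolution f g k + a * (t· convolution f g) k  ∎
    where
    distribute : ∀ i j → f i * (g j + a * (t· g) j) ≈ f i * g j + a * (t· λ j → f i * g j) j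
    distribute i j = begin
      f i * (g j + a * (t· g) j)
        ≈⟨ Solver.solve 4 (λ p a q r → r :* (p :+ a :* q) := r :* p :+ a :* (r :* q))
             refl (g j) a ((t· g) j) (f i) ⟩
      f i * g j + a * (f i * (t· g) j)
        ≈⟨ +-congˡ (*-congˡ (t·-*ˡ (f i) g j)) ⟨
      f i * g j + a * (t· λ j → f i * g j) j  ∎

  -- ∏ (1 + vᵢ t) (1 - vᵢ t) = ∏ (1 - vᵢ² t²), with -1 as a constant a.
  e-squares : ∀ {n a} → 1# + a ≈ 0# → (v : Fin n → Carrier) → ∀ m →
    convolution (e v) (e (λ i → a * v i)) (m ℕ.* 2) ≈ a ^ m * e (λ i → v i * v i) m
  e-squares {zero}  1+a≈0 v zero    = refl
  e-squares {zero}  1+a≈0 v (suc m) = trans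
    (antidiagonal-vanishes (suc m ℕ.* 2) vanish) (sym (zeroʳ _))
    where
    vanish : ∀ i j → i ℕ.+ j ≡ suc m ℕ.* 2 → unit i * unit j ≈ 0#
    vanish (suc i) j       _ = zeroˡ _
    vanish zero    (suc j) _ = zeroʳ _
  e-squares {suc n} {a} 1+a≈0 v m = begin
    convolution (e v) (e (λ i → a * v i)) (m ℕ.* 2)
      ≈⟨ convolution-1+atˡ f x (e (λ i → a * v i)) (m ℕ.* 2) ⟩
    convolution f (e (λ i → a * v i)) (m ℕ.* 2) + x * (t· convolution f (e (λ i → a * v i))) (m ℕ.* 2)
      ≈⟨ +-cong (convolution-1+atʳ f (a * x) g (m ℕ.* 2))
                (*-congˡ (trans (t·-cong (convolution-1+atʳ f (a * x) g) (m ℕ.* 2))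
                                (t·-linear h (a * x) (t· h) (m ℕ.* 2)))) ⟩
    (h (m ℕ.* 2) + a * x * (t· h) (m ℕ.* 2)) + x * ((t· h) (m ℕ.* 2) + a * x * (t· (t· h)) (m ℕ.* 2))
      -- The two cross terms combine to a multiple of `1# + a`, hence cancel.
      ≈⟨ Solver.solve 5 (λ p q r a x → (p :+ a :* x :* q) :+ x :* (q :+ a :* x :* r)
                                       := (p :+ a :* (x :* x) :* r) :+ (con 1 :+ a) :* (x :* q))
           refl (h (m ℕ.* 2)) ((t· h) (m ℕ.* 2)) ((t· (t· h)) (m ℕ.* 2)) a x ⟩
    (h (m ℕ.* 2) + a * (x * x) * (t· (t· h)) (m ℕ.* 2)) + (1# + a) * (x * (t· h) (m ℕ.* 2))
      ≈⟨ +-congˡ (trans (*-congʳ 1+a≈0) (zeroˡ _)) ⟩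
    (h (m ℕ.* 2) + a * (x * x) * (t· (t· h)) (m ℕ.* 2)) + 0#
      ≈⟨ +-identityʳ _ ⟩
    h (m ℕ.* 2) + a * (x * x) * (t· (t· h)) (m ℕ.* 2)
      ≈⟨ step m ⟩
    a ^ m * e (λ i → v i * v i) m  ∎
    where
    x = v zero
    f = e (v ∘ suc)
    g = e (λ i → a * v (suc i))
    h = convolution f g
    E = e (λ i → v (suc i) * v (suc i))
    -- The degree is written `m ℕ.* 2` because `suc m ℕ.* 2` computes to two successors, which the
    -- double shift consumes.
    step : ∀ m → h (m ℕ.* 2) + a * (x * x) * (t· (t· h)) (m ℕ.* 2) ≈ a ^ m * (E m + x * x * (t· E) m)
    step zero = begin
      h 0 + a * (x * x) * 0#       ≈⟨ +-congʳ (e-squares 1+a≈0 (v ∘ suc) 0) ⟩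
      1# * E 0 + a * (x * x) * 0#
        ≈⟨ Solver.solve 3 (λ p a x → con 1 :* p :+ a :* (x :* x) :* con 0
                                     := con 1 :* (p :+ x :* x :* con 0)) refl (E 0) a x ⟩
      1# * (E 0 + x * x * 0#)      ∎
    step (suc m) = begin
      h (suc m ℕ.* 2) + a * (x * x) * h (m ℕ.* 2)
        ≈⟨ +-cong (e-squares 1+a≈0 (v ∘ suc) (suc m)) (*-congˡ (e-squares 1+a≈0 (v ∘ suc) m)) ⟩
      a * a ^ m * E (suc m) + a * (x * x) * (a ^ m * E m)
        ≈⟨ Solver.solve 5 (λ a b p q x → a :* b :* p :+ a :* (x :* x) :* (b :* q)
                                         := a :* b :* (p :+ x :* x :* q))
             refl a (a ^ m) (E (suc m)) (E m) x ⟩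
      a * a ^ m * (E (suc m) + x * x * E m)  ∎

  -1-squared : ∀ {a} → 1# + a ≈ 0# → a * a ≈ 1#
  -1-squared {a} 1+a≈0 = begin
    a * a                    ≈⟨ +-identityʳ _ ⟨
    a * a + 0#               ≈⟨ +-congˡ 1+a≈0 ⟨
    a * a + (1# + a)
      ≈⟨ Solver.solve 1 (λ a → a :* a :+ (con 1 :+ a) := con 1 :+ a :* (con 1 :+ a)) refl a ⟩
    1# + a * (1# + a)        ≈⟨ +-congˡ (trans (*-congˡ 1+a≈0) (zeroʳ a)) ⟩
    1# + 0#                  ≈⟨ +-identityʳ 1# ⟩
    1#                       ∎

  square-root-of-one^ : ∀ {a} → a * a ≈ 1# → ∀ m → a ^ m * a ^ m ≈ 1#
  square-root-of-one^ aa≈1 zero    = *-identityˡ 1#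
  square-root-of-one^ {a} aa≈1 (suc m) = begin
    a * a ^ m * (a * a ^ m)
      ≈⟨ Solver.solve 2 (λ a b → a :* b :* (a :* b) := a :* a :* (b :* b)) refl a (a ^ m) ⟩
    a * a * (a ^ m * a ^ m)  ≈⟨ *-cong aa≈1 (square-root-of-one^ aa≈1 m) ⟩
    1# * 1#                  ≈⟨ *-identityˡ 1# ⟩
    1#                       ∎

  square-root-of-one^even : ∀ {a} → a * a ≈ 1# → ∀ m → a ^ (m ℕ.* 2) ≈ 1#
  square-root-of-one^even aa≈1 zero    = refl
  square-root-of-one^even {a} aa≈1 (suc m) = begin
    a * (a * a ^ (m ℕ.* 2))  ≈⟨ *-assoc a a _ ⟨
    a * a * a ^ (m ℕ.* 2)    ≈⟨ *-cong aa≈1 (square-root-of-one^even aa≈1 m) ⟩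
    1# * 1#                  ≈⟨ *-identityˡ 1# ⟩
    1#                       ∎

  -- Apply e-squares to x and to the constant family 1: the convolution for x
  -- is that for 1 without its two end terms.
  e-squares-binomial : ∀ {n N a b} → 1# + a ≈ 0# → (x : Fin N → Carrier) →
    (∀ k → b * e x k ≈ binomial n (suc k)) → ∀ m →
    b * b * e (λ i → x i * x i) m
      ≈ binomial n (suc m) + a ^ m * (binomial n (suc m ℕ.* 2) + binomial n (suc m ℕ.* 2))
  e-squares-binomial {n} {N} {a} {b} 1+a≈0 x bx m = begin
    b * b * E
      ≈⟨ trans (*-congʳ (square-root-of-one^ aa≈1 m)) (*-identityˡ _) ⟨
    A * A * (b * b * E)
      ≈⟨ Solver.solve 3 (λ A b E → A :* A :* (b :* b :* E) := A :* (b :* b :* (A :* E)))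
           refl A b E ⟩
    A * (b * b * (A * E))
      ≈⟨ *-congˡ inner ⟩
    A * S
      ≈⟨ *-congˡ S≈ ⟩
    A * (A * B (suc m) + (top + top))
      ≈⟨ Solver.solve 3 (λ A p q → A :* (A :* p :+ (q :+ q)) := (A :* A) :* p :+ A :* (q :+ q))
           refl A (B (suc m)) top ⟩
    A * A * B (suc m) + A * (top + top)
      ≈⟨ +-congʳ (trans (*-congʳ (square-root-of-one^ aa≈1 m)) (*-identityˡ _)) ⟩
    B (suc m) + A * (top + top)  ∎
    where
    aa≈1 = -1-squared 1+a≈0
    A = a ^ m
    B = binomial n
    E = e (λ i → x i * x i) m
    top = B (suc m ℕ.* 2)
    S = antidiagonal (m ℕ.* 2) (λ i j → B (suc i) * (a ^ j * B (suc j)))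

    -- One factor `b` goes to each of `e x i` and `e x j`, which raises both indices: degree 2m for
    -- `x` turns into degree 2m + 2 for the family 1.
    inner : b * b * (A * E) ≈ S
    inner = begin
      b * b * (A * E)
        ≈⟨ *-congˡ (e-squares 1+a≈0 x m) ⟨
      b * b * convolution (e x) (e (λ i → a * x i)) (m ℕ.* 2)
        ≈⟨ +-identityˡ _ ⟨
      0# + b * b * convolution (e x) (e (λ i → a * x i)) (m ℕ.* 2)
        ≈⟨ +-congʳ (antidiagonal-vanishes (m ℕ.* 2) (λ _ _ _ → refl)) ⟨
      antidiagonal (m ℕ.* 2) (λ _ _ → 0#) + b * b * convolution (e x) (e (λ i → a * x i)) (m ℕ.* 2)
        ≈⟨ antidiagonal-linear (m ℕ.* 2) (λ _ _ → 0#) (b * b) (λ i j → e x i * e (λ i → a * x i) j) ⟨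
      antidiagonal (m ℕ.* 2) (λ i j → 0# + b * b * (e x i * e (λ i → a * x i) j))
        ≈⟨ antidiagonal-cong (m ℕ.* 2) (λ i j _ → term i j) ⟩
      S  ∎
      where
      term : ∀ i j → 0# + b * b * (e x i * e (λ i → a * x i) j) ≈ B (suc i) * (a ^ j * B (suc j))
      term i j = begin
        0# + b * b * (e x i * e (λ i → a * x i) j)
          ≈⟨ trans (+-identityˡ _) (*-congˡ (*-congˡ (e-scale a x j))) ⟩
        b * b * (e x i * (a ^ j * e x j))
          ≈⟨ Solver.solve 4 (λ b p q r → b :* b :* (p :* (q :* r)) := (b :* p) :* (q :* (b :* r)))
               refl b (e x i) (a ^ j) (e x j) ⟩
        (b * e x i) * (a ^ j * (b * e x j))
          ≈⟨ *-cong (bx i) (*-congˡ (bx j)) ⟩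
        B (suc i) * (a ^ j * B (suc j))  ∎

    F : ℕ → ℕ → Carrier
    F i j = B i * (a ^ j * B j)

    -- The convolution for the family 1 in degree 2m + 2. Both ends give `top`, as an even power of
    -- `a` is 1; the inner terms form `a * S`, since they contain `a ^ suc j` where `S` has `a ^ j`.
    whole : top * (1# * B 0) + (a * S + B 0 * (1# * top)) ≈ a * A * B (suc m)
    whole = begin
      top * (1# * B 0) + (a * S + B 0 * (1# * top))
        ≈⟨ +-congˡ (+-cong aS (*-congˡ (*-congʳ (square-root-of-one^even aa≈1 (suc m))))) ⟨
      F (suc m ℕ.* 2) 0 + (antidiagonal (m ℕ.* 2) (λ i j → F (suc i) (suc j)) + F 0 (suc m ℕ.* 2))
        ≈⟨ +-congˡ (antidiagonal-last (m ℕ.* 2) (λ i j → F i (suc j))) ⟨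
      antidiagonal (suc m ℕ.* 2) F
        ≈⟨ antidiagonal-cong (suc m ℕ.* 2) (λ i j _ → *-congˡ {B i} (e-scale {n} a (λ _ → 1#) j)) ⟨
      convolution B (e {n} (λ _ → a * 1#)) (suc m ℕ.* 2)
        ≈⟨ e-squares {n} 1+a≈0 (λ _ → 1#) (suc m) ⟩
      a ^ suc m * e {n} (λ _ → 1# * 1#) (suc m)
        ≈⟨ *-congˡ (e-cong {n} (λ _ → *-identityˡ 1#) (suc m)) ⟩
      a * A * B (suc m)  ∎
      where
      aS : antidiagonal (m ℕ.* 2) (λ i j → F (suc i) (suc j)) ≈ a * S
      aS = begin
        antidiagonal (m ℕ.* 2) (λ i j → F (suc i) (suc j))
          ≈⟨ antidiagonal-cong (m ℕ.* 2) (λ i j _ →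
               Solver.solve 4 (λ p a q r → p :* (a :* q :* r) := con 0 :+ a :* (p :* (q :* r)))
                 refl (B (suc i)) a (a ^ j) (B (suc j))) ⟩
        antidiagonal (m ℕ.* 2) (λ i j → 0# + a * (B (suc i) * (a ^ j * B (suc j))))
          ≈⟨ antidiagonal-linear (m ℕ.* 2) (λ _ _ → 0#) a (λ i j → B (suc i) * (a ^ j * B (suc j))) ⟩
        antidiagonal (m ℕ.* 2) (λ _ _ → 0#) + a * S
          ≈⟨ +-congʳ (antidiagonal-vanishes (m ℕ.* 2) (λ _ _ _ → refl)) ⟩
        0# + a * S
          ≈⟨ +-identityˡ _ ⟩
        a * S  ∎

    -- Solves `whole` for `S` on multiplying by `a`. The zero `(1# + a) * (top + top)` moves the end
    -- terms across without subtraction.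
    S≈ : S ≈ A * B (suc m) + (top + top)
    S≈ = begin
      S
        ≈⟨ +-identityʳ _ ⟨
      S + 0#
        ≈⟨ +-congˡ (trans (*-congʳ 1+a≈0) (zeroˡ (top + top))) ⟨
      S + (1# + a) * (top + top)
        ≈⟨ +-congʳ (trans (*-congʳ aa≈1) (*-identityˡ S)) ⟨
      a * a * S + (1# + a) * (top + top)
        ≈⟨ Solver.solve 3 (λ a S t → a :* a :* S :+ (con 1 :+ a) :* (t :+ t)
             := a :* (t :* (con 1 :* con 1) :+ (a :* S :+ con 1 :* (con 1 :* t))) :+ (t :+ t))
             refl a S top ⟩
      a * (top * (1# * 1#) + (a * S + 1# * (1# * top))) + (top + top)
        ≈⟨ +-congʳ (*-congˡ (+-cong (*-congˡ (*-congˡ B0)) (+-congˡ (*-congʳ B0)))) ⟨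
      a * (top * (1# * B 0) + (a * S + B 0 * (1# * top))) + (top + top)
        ≈⟨ +-congʳ (*-congˡ whole) ⟩
      a * (a * A * B (suc m)) + (top + top)
        ≈⟨ +-congʳ (Solver.solve 3 (λ a A p → a :* (a :* A :* p) := (a :* a) :* (A :* p))
             refl a A (B (suc m))) ⟩
      a * a * (A * B (suc m)) + (top + top)
        ≈⟨ +-congʳ (trans (*-congʳ aa≈1) (*-identityˡ _)) ⟩
      A * B (suc m) + (top + top)  ∎
      where
      B0 = e-zero {n} (λ _ → 1#)

  -- Induction by Pascal's rule. It turns the binomials of n in degrees m + 1 and 2m + 2 into those
  -- of n - 1 in degrees m and 2m + 1.
  binomial-absorb : ∀ n k → suc k · 1# * binomial (suc n) (suc k) ≈ suc n · 1# * binomial n k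
  binomial-absorb zero zero    = Solver.solve 0
    ((con 1 :+ con 0) :* (con 0 :+ con 1 :* con 1) := (con 1 :+ con 0) :* con 1) refl
  binomial-absorb zero (suc k) = Solver.solve 1
    (λ K → K :* (con 0 :+ con 1 :* con 0) := (con 1 :+ con 0) :* con 0) refl (suc (suc k) · 1#)
  binomial-absorb (suc n) zero = begin
    (1# + 0#) * (p + 1# * q)
      ≈⟨ Solver.solve 2 (λ p q → (con 1 :+ con 0) :* (p :+ con 1 :* q) := (con 1 :+ con 0) :* p :+ q)
           refl p q ⟩
    (1# + 0#) * p + q
      ≈⟨ +-congʳ (binomial-absorb n 0) ⟩
    N * r + q
      ≈⟨ +-congʳ (*-congˡ (trans (+-congˡ (zeroʳ 1#)) (+-identityʳ r))) ⟨
    N * q + q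
      ≈⟨ Solver.solve 2 (λ N q → N :* q :+ q := (con 1 :+ N) :* q) refl N q ⟩
    (1# + N) * q  ∎
    where
    N = suc n · 1#
    p = binomial (suc n) 1
    q = binomial (suc n) 0
    r = binomial n 0
  binomial-absorb (suc n) (suc k) = begin
    (1# + K) * (p + 1# * q)
      ≈⟨ Solver.solve 3 (λ K p q → (con 1 :+ K) :* (p :+ con 1 :* q)
                                   := ((con 1 :+ K) :* p :+ K :* q) :+ q) refl K p q ⟩
    ((1# + K) * p + K * q) + q
      ≈⟨ +-congʳ (+-cong (binomial-absorb n (suc k)) (binomial-absorb n k)) ⟩
    (N * r + N * s) + q
      ≈⟨ Solver.solve 3 (λ N r s → (N :* r :+ N :* s) :+ (r :+ con 1 :* s)
                                   := (con 1 :+ N) :* (r :+ con 1 :* s)) refl N r s ⟩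
    (1# + N) * q  ∎
    where
    K = suc k · 1#
    N = suc n · 1#
    p = binomial (suc n) (suc (suc k))
    q = binomial (suc n) (suc k)
    r = binomial n (suc k)
    s = binomial n k

  -- Monomial symmetric functions with exponents at most 3

  -- The monomial symmetric function with a exponents 3, b exponents 2 and c exponents 1.
  monomial : ∀ {n} → (Fin n → Carrier) → ℕ → ℕ → ℕ → Carrier
  monomial {zero}  x a b c = unit (a ℕ.+ b ℕ.+ c)
  monomial {suc n} x a b c =
    M a b c + (x zero ^ 3 * (t· λ a → M a b c) a
            + (x zero ^ 2 * (t· λ b → M a b c) b
            +  x zero ^ 1 * (t· λ c → M a b c) c))
    where
    M = monomial (x ∘ suc)

  monomial-vanishes : ∀ {n} (x : Fin n → Carrier) a b c {k} →
                      a ℕ.+ b ℕ.+ c ≡ k → n < k → monomial x a b c ≈ 0#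
  monomial-vanishes {zero}  x a b c {suc k} eq _ rewrite eq = refl
  monomial-vanishes {suc n} x a b c {suc k} eq (s≤s n<k) = begin
    M a b c + (x zero ^ 3 * (t· λ a → M a b c) a
            + (x zero ^ 2 * (t· λ b → M a b c) b
            +  x zero ^ 1 * (t· λ c → M a b c) c))
      ≈⟨ +-cong (monomial-vanishes (x ∘ suc) a b c eq (ℕ.m<n⇒m<1+n n<k))
         (+-cong (*-congˡ (t·-vanishes a λ { a ≡.refl →
                   monomial-vanishes (x ∘ suc) a b c (ℕ.suc-injective eq) n<k }))
         (+-cong (*-congˡ (t·-vanishes b λ { b ≡.refl →
                   monomial-vanishes (x ∘ suc) a b c (+-suc₂ a b c eq) n<k }))
                 (*-congˡ (t·-vanishes c λ { c ≡.refl →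
                   monomial-vanishes (x ∘ suc) a b c (+-suc₁ a b c eq) n<k })))) ⟩
    0# + (x zero ^ 3 * 0# + (x zero ^ 2 * 0# + x zero ^ 1 * 0#))
      ≈⟨ Solver.solve 3 (λ p q r → con 0 :+ (p :* con 0 :+ (q :* con 0 :+ r :* con 0)) := con 0)
           refl (x zero ^ 3) (x zero ^ 2) (x zero ^ 1) ⟩
    0#  ∎
    where
    M = monomial (x ∘ suc)

  -- The factor ∏ xᵢ raises every exponent by one: 2, 1, 0 become 3, 2, 1. As `a + b + c` counts all
  -- variables, the `c` variables absent on the left are those of exponent 1 on the right.
  monomial-shift : ∀ {n} (x : Fin n → Carrier) a b c → a ℕ.+ b ℕ.+ c ≡ n →
                   product x * monomial x 0 a b ≈ monomial x a b c
  monomial-shift {zero}  x zero zero zero eq = *-identityˡ 1#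
  monomial-shift {suc n} x a b c eq = begin
    x₀ * P * (M 0 a b + (x₀ ^ 3 * 0# + (x₀ ^ 2 * (t· λ a → M 0 a b) a + x₀ ^ 1 * (t· λ b → M 0 a b) b)))
      ≈⟨ Solver.solve 5 (λ x P p q r →
           x :* P :* (p :+ (x :* (x :* (x :* con 1)) :* con 0
                         :+ (x :* (x :* con 1) :* q :+ x :* con 1 :* r)))
             := con 0 :+ (x :* (x :* (x :* con 1)) :* (P :* q)
                      :+ (x :* (x :* con 1) :* (P :* r) :+ x :* con 1 :* (P :* p))))
           refl x₀ P (M 0 a b) ((t· λ a → M 0 a b) a) ((t· λ b → M 0 a b) b) ⟩
    0# + (x₀ ^ 3 * (P * (t· λ a → M 0 a b) a) + (x₀ ^ 2 * (P * (t· λ b → M 0 a b) b) + x₀ ^ 1 * (P * M 0 a b)))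
      ≈⟨ +-cong (sym (monomial-vanishes x′ a b c eq (ℕ.n<1+n n)))
         (+-cong (*-congˡ three) (+-cong (*-congˡ two) (*-congˡ (one c eq)))) ⟩
    M a b c + (x₀ ^ 3 * (t· λ a → M a b c) a + (x₀ ^ 2 * (t· λ b → M a b c) b + x₀ ^ 1 * (t· λ c → M a b c) c))  ∎
    where
    x₀ = x zero
    x′ = x ∘ suc
    M = monomial x′
    P = product x′
    three : P * (t· λ a → M 0 a b) a ≈ (t· λ a → M a b c) a
    three = trans (sym (t·-*ˡ P (λ a → M 0 a b) a)) (t·-local a λ { a ≡.refl →
      monomial-shift x′ a b c (ℕ.suc-injective eq) })
    two : P * (t· λ b → M 0 a b) b ≈ (t· λ b → M a b c) b
    two = trans (sym (t·-*ˡ P (λ b → M 0 a b) b)) (t·-local b λ { b ≡.refl →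
      monomial-shift x′ a b c (+-suc₂ a b c eq) })
    one : ∀ c → a ℕ.+ b ℕ.+ c ≡ suc n → P * M 0 a b ≈ (t· λ c → M a b c) c
    one zero    eq = trans (*-congˡ (monomial-vanishes x′ 0 a b
      (≡.trans (≡.sym (ℕ.+-identityʳ (a ℕ.+ b))) eq) (ℕ.n<1+n n))) (zeroʳ P)
    one (suc c) eq = monomial-shift x′ a b c (+-suc₁ a b c eq)

  -- The value of the linear functional tᵏ ↦ g(k) at ∏ (1 + yᵢ t).
  evaluate : ∀ {n} → (Fin n → Carrier) → (ℕ → Carrier) → Carrier
  evaluate {zero}  y g = g 0
  evaluate {suc n} y g = evaluate (y ∘ suc) g + y zero * evaluate (y ∘ suc) (g ∘ suc)

  δ : ℕ → ℕ → Carrier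
  δ zero    k       = unit k
  δ (suc i) zero    = 0#
  δ (suc i) (suc k) = δ i k

  evaluate-zero : ∀ {n} (y : Fin n → Carrier) → evaluate y (λ _ → 0#) ≈ 0#
  evaluate-zero {zero}  y = refl
  evaluate-zero {suc n} y = begin
    evaluate (y ∘ suc) (λ _ → 0#) + y zero * evaluate (y ∘ suc) (λ _ → 0#)
      ≈⟨ +-cong (evaluate-zero (y ∘ suc)) (*-congˡ (evaluate-zero (y ∘ suc))) ⟩
    0# + y zero * 0#  ≈⟨ +-identityˡ _ ⟩
    y zero * 0#       ≈⟨ zeroʳ _ ⟩
    0#                ∎

  -- The functional `δ k` reads off the coefficient of tᵏ. Up to this choice `g` stays arbitrary, so
  -- that an induction can pass to `g ∘ suc` instead of lowering ℓ.
  evaluate-δ : ∀ {n} (y : Fin n → Carrier) k → evaluate y (δ k) ≈ e y k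
  evaluate-δ {zero}  y zero    = refl
  evaluate-δ {zero}  y (suc k) = refl
  evaluate-δ {suc n} y zero    =
    +-cong (evaluate-δ (y ∘ suc) zero) (*-congˡ (evaluate-zero (y ∘ suc)))
  evaluate-δ {suc n} y (suc k) =
    +-cong (evaluate-δ (y ∘ suc) (suc k)) (*-congˡ (evaluate-δ (y ∘ suc) k))

  antidiagonal-δ : ∀ i k (F : ℕ → ℕ → Carrier) → antidiagonal (i ℕ.+ k) (λ a b → δ k b * F a b) ≈ F i k
  antidiagonal-δ zero    zero    F = *-identityˡ _
  antidiagonal-δ (suc i) zero    F = begin
    1# * F (suc (i ℕ.+ 0)) 0 + antidiagonal (i ℕ.+ 0) (λ a b → 0# * F a (suc b))
      ≈⟨ +-cong (*-identityˡ _) (antidiagonal-vanishes (i ℕ.+ 0) (λ _ _ _ → zeroˡ _)) ⟩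
    F (suc (i ℕ.+ 0)) 0 + 0#
      ≈⟨ +-identityʳ _ ⟩
    F (suc (i ℕ.+ 0)) 0
      ≡⟨ ≡.cong (λ k → F (suc k) 0) (ℕ.+-identityʳ i) ⟩
    F (suc i) 0  ∎
  antidiagonal-δ i (suc k) F rewrite ℕ.+-suc i k = begin
    0# * F (suc (i ℕ.+ k)) 0 + antidiagonal (i ℕ.+ k) (λ a b → δ k b * F a (suc b))
      ≈⟨ +-cong (zeroˡ _) (antidiagonal-δ i k (λ a b → F a (suc b))) ⟩
    0# + F i (suc k)
      ≈⟨ +-identityˡ _ ⟩
    F i (suc k)  ∎

  δ-+ : ∀ d i k → δ (d ℕ.+ i) (k ℕ.+ d) ≡ δ i k
  δ-+ zero    i k = ≡.cong (δ i) (ℕ.+-identityʳ k)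
  δ-+ (suc d) i k = ≡.trans (≡.cong (δ (suc (d ℕ.+ i))) (ℕ.+-suc k d)) (δ-+ d i k)

  δ-< : ∀ {i k} → i < k → δ i k ≡ 0#
  δ-< {zero}  {suc k} _         = ≡.refl
  δ-< {suc i} {suc k} (s≤s i<k) = δ-< i<k

  -- Choosing exponents 3, 2, 1, 0 at the positions a, b, c, d expands ∏ (1 + s xᵢ²)(xᵢ + t),
  -- with m = a + b the degree in s and b + d that in t.
  sumOfMonomials : ∀ {n} → (Fin n → Carrier) → ℕ → ℕ → (ℕ → Carrier) → Carrier
  sumOfMonomials x m p g =
    antidiagonal p (λ c d → antidiagonal m (λ a b → g (b ℕ.+ d) * monomial x a b c))

  -- The four summands give the first variable the exponent 0, 3, 2, 1 and lower d, a, b, c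
  -- respectively. Only b and d count towards the degree in t, whence `g ∘ suc` in their summands.
  sumOfMonomials-step : ∀ {n} (x : Fin (suc n) → Carrier) m p g → m ℕ.+ p ≡ suc n →
    sumOfMonomials x m p g ≈
      (t· λ p → sumOfMonomials (x ∘ suc) m p (g ∘ suc)) p
      + x zero ^ 3 * (t· λ m → sumOfMonomials (x ∘ suc) m p g) m
      + x zero ^ 2 * (t· λ m → sumOfMonomials (x ∘ suc) m p (g ∘ suc)) m
      + x zero ^ 1 * (t· λ p → sumOfMonomials (x ∘ suc) m p g) p
  sumOfMonomials-step {n} x m p g m+p≡1+n = begin
    sumOfMonomials x m p g
      ≈⟨ ∑-cong (λ a b c d _ _ → pick a b c d) ⟩
    ∑ (λ a b c d → F a b c d + x₀ ^ 3 * F₃ a b c d + x₀ ^ 2 * F₂ a b c d + x₀ ^ 1 * F₁ a b c d)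
      ≈⟨ ∑-linear _ _ F₁ ⟩
    ∑ (λ a b c d → F a b c d + x₀ ^ 3 * F₃ a b c d + x₀ ^ 2 * F₂ a b c d) + x₀ ^ 1 * ∑ F₁
      ≈⟨ +-congʳ (∑-linear _ _ F₂) ⟩
    ∑ (λ a b c d → F a b c d + x₀ ^ 3 * F₃ a b c d) + x₀ ^ 2 * ∑ F₂ + x₀ ^ 1 * ∑ F₁
      ≈⟨ +-congʳ (+-congʳ (∑-linear F _ F₃)) ⟩
    ∑ F + x₀ ^ 3 * ∑ F₃ + x₀ ^ 2 * ∑ F₂ + x₀ ^ 1 * ∑ F₁
      ≈⟨ +-cong (+-cong (+-cong (∑F p m+p≡1+n) (*-congˡ ∑F₃)) (*-congˡ ∑F₂)) (*-congˡ ∑F₁) ⟩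
    (t· λ p → H m p (g ∘ suc)) p + x₀ ^ 3 * (t· λ m → H m p g) m
      + x₀ ^ 2 * (t· λ m → H m p (g ∘ suc)) m + x₀ ^ 1 * (t· λ p → H m p g) p  ∎
    where
    x₀ = x zero
    M = monomial (x ∘ suc)
    H = sumOfMonomials (x ∘ suc)

    ∑ : (ℕ → ℕ → ℕ → ℕ → Carrier) → Carrier
    ∑ F = antidiagonal p (λ c d → antidiagonal m (λ a b → F a b c d))

    ∑-cong : ∀ {F G} → (∀ a b c d → a ℕ.+ b ≡ m → c ℕ.+ d ≡ p → F a b c d ≈ G a b c d) → ∑ F ≈ ∑ G
    ∑-cong F≈G = antidiagonal-cong p λ c d c+d≡p → antidiagonal-cong m λ a b a+b≡m → F≈G a b c d a+b≡m c+d≡p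

    ∑-linear : ∀ F α G → ∑ (λ a b c d → F a b c d + α * G a b c d) ≈ ∑ F + α * ∑ G
    ∑-linear F α G = trans
      (antidiagonal-cong p λ c d _ → antidiagonal-linear m (λ a b → F a b c d) α (λ a b → G a b c d))
      (antidiagonal-linear p _ α _)

    F F₃ F₂ F₁ : ℕ → ℕ → ℕ → ℕ → Carrier
    F  a b c d = g (b ℕ.+ d) * M a b c
    F₃ a b c d = (t· λ a → g (b ℕ.+ d) * M a b c) a
    F₂ a b c d = (t· λ b → g (suc (b ℕ.+ d)) * M a b c) b
    F₁ a b c d = (t· λ c → g (b ℕ.+ d) * M a b c) c

    pick : ∀ a b c d → g (b ℕ.+ d) * monomial x a b c ≈
           F a b c d + x₀ ^ 3 * F₃ a b c d + x₀ ^ 2 * F₂ a b c d + x₀ ^ 1 * F₁ a b c d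
    pick a b c d = begin
      g (b ℕ.+ d) * (M a b c + (x₀ ^ 3 * (t· λ a → M a b c) a
                   + (x₀ ^ 2 * (t· λ b → M a b c) b + x₀ ^ 1 * (t· λ c → M a b c) c)))
        ≈⟨ Solver.solve 8 (λ g p α q β r γ s →
             g :* (p :+ (α :* q :+ (β :* r :+ γ :* s)))
               := g :* p :+ α :* (g :* q) :+ β :* (g :* r) :+ γ :* (g :* s))
             refl (g (b ℕ.+ d)) (M a b c) (x₀ ^ 3) ((t· λ a → M a b c) a)
             (x₀ ^ 2) ((t· λ b → M a b c) b) (x₀ ^ 1) ((t· λ c → M a b c) c) ⟩
      g (b ℕ.+ d) * M a b c + x₀ ^ 3 * (g (b ℕ.+ d) * (t· λ a → M a b c) a)
        + x₀ ^ 2 * (g (b ℕ.+ d) * (t· λ b → M a b c) b)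
        + x₀ ^ 1 * (g (b ℕ.+ d) * (t· λ c → M a b c) c)
        ≈⟨ +-cong (+-cong (+-congˡ (*-congˡ (sym (t·-*ˡ _ (λ a → M a b c) a))))
                          (*-congˡ (pick₂ b)))
                  (*-congˡ (sym (t·-*ˡ _ (M a b) c))) ⟩
      F a b c d + x₀ ^ 3 * F₃ a b c d + x₀ ^ 2 * F₂ a b c d + x₀ ^ 1 * F₁ a b c d  ∎
      where
      pick₂ : ∀ b → g (b ℕ.+ d) * (t· λ b → M a b c) b ≈ F₂ a b c d
      pick₂ zero    = zeroʳ _
      pick₂ (suc b) = refl

    ∑F₃ : ∑ F₃ ≈ (t· λ m → H m p g) m
    ∑F₃ = trans
      (antidiagonal-cong p λ c d _ → antidiagonal-t·ˡ m (λ a b → F a b c d))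
      (antidiagonal-t· p (λ m c d → antidiagonal m (λ a b → F a b c d)) m)

    ∑F₂ : ∑ F₂ ≈ (t· λ m → H m p (g ∘ suc)) m
    ∑F₂ = trans
      (antidiagonal-cong p λ c d _ → antidiagonal-t·ʳ m (λ a b → g (suc (b ℕ.+ d)) * M a b c))
      (antidiagonal-t· p (λ m c d → antidiagonal m (λ a b → g (suc (b ℕ.+ d)) * M a b c)) m)

    ∑F₁ : ∑ F₁ ≈ (t· λ p → H m p g) p
    ∑F₁ = trans
      (antidiagonal-cong p λ c d _ → antidiagonal-t· m (λ c a b → F a b c d) c)
      (antidiagonal-t·ˡ p (λ c d → antidiagonal m (λ a b → F a b c d)))

    inner-vanishes : ∀ c d → m ℕ.+ c ≡ suc n → antidiagonal m (λ a b → F a b c d) ≈ 0#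
    inner-vanishes c d m+c = antidiagonal-vanishes m λ a b a+b≡m → trans
      (*-congˡ (monomial-vanishes (x ∘ suc) a b c (≡.trans (≡.cong (ℕ._+ c) a+b≡m) m+c) (ℕ.n<1+n n)))
      (zeroʳ _)

    -- With `d = 0` the remaining n variables would have to carry n + 1 positive exponents. So only
    -- positive d contribute, and one unit of d belongs to the first variable.
    ∑F : ∀ p → m ℕ.+ p ≡ suc n →
      antidiagonal p (λ c d → antidiagonal m (λ a b → F a b c d)) ≈ (t· λ p → H m p (g ∘ suc)) p
    ∑F zero    eq = inner-vanishes 0 0 eq
    ∑F (suc p) eq = trans (+-cong (inner-vanishes (suc p) 0 eq)
      (antidiagonal-cong p λ c d _ → antidiagonal-cong m λ a b _ →
        *-congʳ (reflexive (≡.cong g (ℕ.+-suc b d))))) (+-identityˡ _)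

  -- One more variable contributes (1 + s x₀²)(x₀ + t) on the left and x₀ (1 + s x₀²)(1 + y₀ t) on
  -- the right, which agree as x₀ y₀ = 1.
  sumOfMonomials-factors : ∀ {n} (x y : Fin n → Carrier) → (∀ i → x i * y i ≈ 1#) →
    ∀ m p g → m ℕ.+ p ≡ n →
    sumOfMonomials x m p g ≈ product x * (e (λ i → x i * x i) m * evaluate y g)
  sumOfMonomials-factors {zero} x y xy≈1 zero zero g _ =
    Solver.solve 1 (λ g → g :* con 1 := con 1 :* (con 1 :* g)) refl (g 0)
  sumOfMonomials-factors {suc n} x y xy≈1 m p g m+p≡1+n = begin
    sumOfMonomials x m p g
      ≈⟨ sumOfMonomials-step x m p g m+p≡1+n ⟩
    (t· λ p → H m p (g ∘ suc)) p + x₀ ^ 3 * (t· λ m → H m p g) m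
      + x₀ ^ 2 * (t· λ m → H m p (g ∘ suc)) m + x₀ ^ 1 * (t· λ p → H m p g) p
      ≈⟨ +-cong (+-cong (+-cong (at-p (g ∘ suc) p m+p≡1+n) (*-congˡ (at-m g m m+p≡1+n)))
                        (*-congˡ (at-m (g ∘ suc) m m+p≡1+n)))
                (*-congˡ (at-p g p m+p≡1+n)) ⟩
    P * (E m * G₁) + x₀ ^ 3 * (P * ((t· E) m * G₀)) + x₀ ^ 2 * (P * ((t· E) m * G₁))
      + x₀ ^ 1 * (P * (E m * G₀))
      -- Inserting `x₀ * y₀` into the two terms with `G₁` gives them their `y₀` and makes `x₀` a
      -- common factor of all four.
      ≈⟨ +-congʳ (+-cong (+-congʳ (trans (*-congʳ (xy≈1 zero)) (*-identityˡ _)))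
           (*-congˡ (trans (*-congʳ (xy≈1 zero)) (*-identityˡ _)))) ⟨
    x₀ * y₀ * (P * (E m * G₁)) + x₀ ^ 3 * (P * ((t· E) m * G₀))
      + x₀ ^ 2 * (x₀ * y₀ * (P * ((t· E) m * G₁))) + x₀ ^ 1 * (P * (E m * G₀))
      ≈⟨ Solver.solve 7 (λ x y P E T G₀ G₁ →
           x :* y :* (P :* (E :* G₁)) :+ x :* (x :* (x :* con 1)) :* (P :* (T :* G₀))
             :+ x :* (x :* con 1) :* (x :* y :* (P :* (T :* G₁))) :+ x :* con 1 :* (P :* (E :* G₀))
           := x :* P :* ((E :+ x :* x :* T) :* (G₀ :+ y :* G₁)))
           refl x₀ y₀ P (E m) ((t· E) m) G₀ G₁ ⟩
    x₀ * P * ((E m + x₀ * x₀ * (t· E) m) * (G₀ + y₀ * G₁))  ∎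
    where
    x₀ = x zero
    y₀ = y zero
    x′ = x ∘ suc
    y′ = y ∘ suc
    P = product x′
    E = e (λ i → x′ i * x′ i)
    G₀ = evaluate y′ g
    G₁ = evaluate y′ (g ∘ suc)
    H = sumOfMonomials x′

    at-m : ∀ g m → m ℕ.+ p ≡ suc n →
           (t· λ m → H m p g) m ≈ P * ((t· E) m * evaluate y′ g)
    at-m g zero    eq = sym (trans (*-congˡ (zeroˡ _)) (zeroʳ P))
    at-m g (suc m) eq = sumOfMonomials-factors x′ y′ (xy≈1 ∘ suc) m p g (ℕ.suc-injective eq)

    at-p : ∀ g p → m ℕ.+ p ≡ suc n →
           (t· λ p → H m p g) p ≈ P * (E m * evaluate y′ g)
    at-p g zero    eq = sym (trans (*-congˡ (trans (*-congʳ (e-vanishes (λ i → x′ i * x′ i)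
      (ℕ.≤-reflexive (≡.trans (≡.sym eq) (ℕ.+-identityʳ m))))) (zeroˡ _))) (zeroʳ P))
    at-p g (suc p) eq = sumOfMonomials-factors x′ y′ (xy≈1 ∘ suc) m p g
      (ℕ.suc-injective (≡.trans (≡.sym (ℕ.+-suc m p)) eq))

-- From sums over rearrangements to monomial symmetric functions

module WordSums {c ℓ₁ ℓ₂} (K : HeytingField c ℓ₁ ℓ₂) where

  open HeytingField K using (heytingCommutativeRing)
  open HeytingCommutativeRing heytingCommutativeRing using (commutativeRing)
  open CommutativeRing commutativeRing hiding (zero)
  open RootOfUnitySums K using (_^_; sumList; productList; IsPrimitiveRoot; recip; 𝒴-list)
  open SymmetricFunctions commutativeRing
  import Algebra.Solver.Ring.NaturalCoefficients.Default commutativeSemiring as Solver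
  open Solver using (_:+_; _:*_; _:=_; con)
  open import Relation.Binary.Reasoning.Setoid setoid

  sumOver : ∀ {a} {A : Set a} → (A → Carrier) → List A → Carrier
  sumOver f xs = sumList (map f xs)

  sumOver-++ : ∀ {a} {A : Set a} (f : A → Carrier) xs ys →
               sumOver f (xs ++ ys) ≈ sumOver f xs + sumOver f ys
  sumOver-++ f []       ys = sym (+-identityˡ _)
  sumOver-++ f (x ∷ xs) ys = trans (+-congˡ (sumOver-++ f xs ys)) (sym (+-assoc _ _ _))

  sumOver-↭ : ∀ {a} {A : Set a} (f : A → Carrier) {xs ys} → xs ↭ ys → sumOver f xs ≈ sumOver f ys
  sumOver-↭ f ↭.refl        = refl
  sumOver-↭ f (prep x p)    = +-congˡ (sumOver-↭ f p)
  sumOver-↭ f (swap x y p)  = trans (+-congˡ (+-congˡ (sumOver-↭ f p)))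
    (Solver.solve 3 (λ x y s → x :+ (y :+ s) := y :+ (x :+ s)) refl (f x) (f y) _)
  sumOver-↭ f (↭.trans p q) = trans (sumOver-↭ f p) (sumOver-↭ f q)

  sumOver-linear : ∀ {a} {A : Set a} (f : A → Carrier) α (g : A → Carrier) xs →
                   sumOver (λ x → f x + α * g x) xs ≈ sumOver f xs + α * sumOver g xs
  sumOver-linear f α g []       = sym (trans (+-identityˡ _) (zeroʳ α))
  sumOver-linear f α g (x ∷ xs) = trans (+-congˡ (sumOver-linear f α g xs))
    (Solver.solve 5 (λ p α q r s → (p :+ α :* q) :+ (r :+ α :* s) := (p :+ r) :+ α :* (q :+ s))
      refl (f x) α (g x) (sumOver f xs) (sumOver g xs))

  sumOver-cong : ∀ {a} {A : Set a} {f g : A → Carrier} → (∀ x → f x ≈ g x) →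
                 ∀ xs → sumOver f xs ≈ sumOver g xs
  sumOver-cong f≈g []       = refl
  sumOver-cong f≈g (x ∷ xs) = +-cong (f≈g x) (sumOver-cong f≈g xs)

  sumOver-*ˡ : ∀ {a} {A : Set a} α (f : A → Carrier) xs → sumOver (λ x → α * f x) xs ≈ α * sumOver f xs
  sumOver-*ˡ α f []       = sym (zeroʳ α)
  sumOver-*ˡ α f (x ∷ xs) = trans (+-congˡ (sumOver-*ˡ α f xs)) (sym (distribˡ α _ _))

  sumOver-map : ∀ {a b} {A : Set a} {B : Set b} (f : B → Carrier) (h : A → B) xs →
                sumOver f (map h xs) ≈ sumOver (f ∘ h) xs
  sumOver-map f h []       = refl
  sumOver-map f h (x ∷ xs) = +-congˡ (sumOver-map f h xs)

  module _ {i} {I : Set i} (x : I → Carrier) where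

    power : List ℕ → List I → Carrier
    power s is = productList (zipWith (λ i sₖ → x i ^ sₖ) is s)

    -- This is ℨ over an arbitrary index list, which can shrink in an induction; at `allFin (n ∸ 1)`
    -- it is ℨ by definition.
    wordSum : List I → List ℕ → Carrier
    wordSum is s = sumOver (power s) (subsequences (length s) is)

    wordSum-∷ : ∀ i is v s → wordSum (i ∷ is) (v ∷ s) ≈ wordSum is (v ∷ s) + x i ^ v * wordSum is s
    wordSum-∷ i is v s = begin
      sumOver (power (v ∷ s)) (map (i ∷_) S ++ S′)
        ≈⟨ sumOver-++ (power (v ∷ s)) (map (i ∷_) S) S′ ⟩
      sumOver (power (v ∷ s)) (map (i ∷_) S) + wordSum is (v ∷ s)
        ≈⟨ +-congʳ (trans (sumOver-map (power (v ∷ s)) (i ∷_) S) (sumOver-*ˡ (x i ^ v) (power s) S)) ⟩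
      x i ^ v * wordSum is s + wordSum is (v ∷ s)
        ≈⟨ +-comm _ _ ⟩
      wordSum is (v ∷ s) + x i ^ v * wordSum is s  ∎
      where
      S = subsequences (length s) is
      S′ = subsequences (suc (length s)) is

    sumOver-prepend-[] : ∀ v L k → sumOver (wordSum []) (prepend v L k) ≈ 0#
    sumOver-prepend-[] v L zero    = refl
    sumOver-prepend-[] v L (suc k) = trans (sumOver-map (wordSum []) (v ∷_) (L k)) (zeros (L k))
      where
      zeros : ∀ ss → sumOver (λ _ → 0#) ss ≈ 0#
      zeros []       = refl
      zeros (_ ∷ ss) = trans (+-identityˡ _) (zeros ss)

    sumOver-prepend-∷ : ∀ i is v L k →
      sumOver (wordSum (i ∷ is)) (prepend v L k)
        ≈ sumOver (wordSum is) (prepend v L k) + x i ^ v * (t· λ k → sumOver (wordSum is) (L k)) k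
    sumOver-prepend-∷ i is v L zero    = sym (trans (+-identityˡ _) (zeroʳ _))
    sumOver-prepend-∷ i is v L (suc k) = begin
      sumOver (wordSum (i ∷ is)) (map (v ∷_) (L k))
        ≈⟨ sumOver-map (wordSum (i ∷ is)) (v ∷_) (L k) ⟩
      sumOver (λ s → wordSum (i ∷ is) (v ∷ s)) (L k)
        ≈⟨ sumOver-cong (wordSum-∷ i is v) (L k) ⟩
      sumOver (λ s → wordSum is (v ∷ s) + x i ^ v * wordSum is s) (L k)
        ≈⟨ sumOver-linear (λ s → wordSum is (v ∷ s)) (x i ^ v) (wordSum is) (L k) ⟩
      sumOver (λ s → wordSum is (v ∷ s)) (L k) + x i ^ v * sumOver (wordSum is) (L k)
        ≈⟨ +-congʳ (sumOver-map (wordSum is) (v ∷_) (L k)) ⟨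
      sumOver (wordSum is) (map (v ∷_) (L k)) + x i ^ v * sumOver (wordSum is) (L k)  ∎

    sumOver-words-suc : ∀ is k a b c →
      sumOver (wordSum is) (words (suc k) a b c)
        ≈ sumOver (wordSum is) (prepend 3 (λ a → words k a b c) a)
          + (sumOver (wordSum is) (prepend 2 (λ b → words k a b c) b)
          +  sumOver (wordSum is) (prepend 1 (λ c → words k a b c) c))
    sumOver-words-suc is k a b c = trans
      (sumOver-++ (wordSum is) (prepend 3 (λ a → words k a b c) a) _)
      (+-congˡ (sumOver-++ (wordSum is) (prepend 2 (λ b → words k a b c) b) _))

    -- The first index is either skipped, which leaves the words unchanged, or takes the first
    -- letter of the word as its exponent. This is the recursion of `monomial`. The map `f` is
    -- general because the tail of `tabulate f` is `tabulate (f ∘ suc)`.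
    wordSum-monomial : ∀ {n} (f : Fin n → I) k a b c → a ℕ.+ b ℕ.+ c ≡ k →
      sumOver (wordSum (tabulate f)) (words k a b c) ≈ monomial (x ∘ f) a b c
    wordSum-monomial {zero}  f zero zero zero zero _ = trans (+-identityʳ _) (+-identityʳ 1#)
    wordSum-monomial {suc n} f zero zero zero zero _ = begin
      sumOver (wordSum (tabulate f)) ([] ∷ [])
        ≈⟨ wordSum-monomial (f ∘ suc) zero zero zero zero ≡.refl ⟩
      M
        ≈⟨ Solver.solve 4 (λ p q r s → p := p :+ (q :* con 0 :+ (r :* con 0 :+ s :* con 0)))
             refl M (x₀ ^ 3) (x₀ ^ 2) (x₀ ^ 1) ⟩
      M + (x₀ ^ 3 * 0# + (x₀ ^ 2 * 0# + x₀ ^ 1 * 0#))  ∎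
      where
      x₀ = x (f zero)
      M = monomial (x ∘ f ∘ suc) 0 0 0
    wordSum-monomial {zero}  f (suc k) a b c eq = begin
      sumOver (wordSum []) (words (suc k) a b c)
        ≈⟨ sumOver-words-suc [] k a b c ⟩
      sumOver (wordSum []) (prepend 3 (λ a → words k a b c) a)
        + (sumOver (wordSum []) (prepend 2 (λ b → words k a b c) b)
        +  sumOver (wordSum []) (prepend 1 (λ c → words k a b c) c))
        ≈⟨ +-cong (sumOver-prepend-[] 3 _ a) (+-cong (sumOver-prepend-[] 2 _ b) (sumOver-prepend-[] 1 _ c)) ⟩
      0# + (0# + 0#)
        ≈⟨ trans (+-identityˡ _) (+-identityˡ _) ⟩
      0#
        ≡⟨ ≡.cong unit eq ⟨
      unit (a ℕ.+ b ℕ.+ c)  ∎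
    wordSum-monomial {suc n} f (suc k) a b c eq = begin
      sumOver (wordSum (tabulate f)) (words (suc k) a b c)
        ≈⟨ sumOver-words-suc (tabulate f) k a b c ⟩
      sumOver (wordSum (tabulate f)) W₃
        + (sumOver (wordSum (tabulate f)) W₂ + sumOver (wordSum (tabulate f)) W₁)
        ≈⟨ +-cong (sumOver-prepend-∷ (f zero) is 3 _ a)
           (+-cong (sumOver-prepend-∷ (f zero) is 2 _ b) (sumOver-prepend-∷ (f zero) is 1 _ c)) ⟩
      (Σ W₃ + x₀ ^ 3 * (t· λ a → Σ (words k a b c)) a)
        + ((Σ W₂ + x₀ ^ 2 * (t· λ b → Σ (words k a b c)) b)
        +  (Σ W₁ + x₀ ^ 1 * (t· λ c → Σ (words k a b c)) c))
        ≈⟨ Solver.solve 6 (λ p q r s t u → (p :+ q) :+ ((r :+ s) :+ (t :+ u))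
                                           := (p :+ (r :+ t)) :+ (q :+ (s :+ u)))
             refl (Σ W₃) _ (Σ W₂) _ (Σ W₁) _ ⟩
      (Σ W₃ + (Σ W₂ + Σ W₁))
        + (x₀ ^ 3 * (t· λ a → Σ (words k a b c)) a
        + (x₀ ^ 2 * (t· λ b → Σ (words k a b c)) b
        +  x₀ ^ 1 * (t· λ c → Σ (words k a b c)) c))
        ≈⟨ +-cong (trans (sym (sumOver-words-suc is k a b c)) (wordSum-monomial (f ∘ suc) (suc k) a b c eq))
           (+-cong (*-congˡ (t·-local a λ { a ≡.refl →
                     wordSum-monomial (f ∘ suc) k a b c (ℕ.suc-injective eq) }))
           (+-cong (*-congˡ (t·-local b λ { b ≡.refl →
                     wordSum-monomial (f ∘ suc) k a b c (+-suc₂ a b c eq) }))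
                   (*-congˡ (t·-local c λ { c ≡.refl →
                     wordSum-monomial (f ∘ suc) k a b c (+-suc₁ a b c eq) })))) ⟩
      monomial (x ∘ f) a b c  ∎
      where
      is = tabulate (f ∘ suc)
      x₀ = x (f zero)
      Σ = sumOver (wordSum is)
      W₃ = prepend 3 (λ a → words k a b c) a
      W₂ = prepend 2 (λ b → words k a b c) b
      W₁ = prepend 1 (λ c → words k a b c) c

  𝒴-list-monomial : ∀ {n ζ} (prim : IsPrimitiveRoot n ζ) a b c →
                    𝒴-list prim (blocks a b c) ≈ monomial (recip prim) a b c
  𝒴-list-monomial {n} prim a b c = trans
    (sumOver-↭ (wordSum (recip prim) (allFin (n ∸ 1))) (rearrangements-blocks a b c))
    (wordSum-monomial (recip prim) id (a ℕ.+ b ℕ.+ c) a b c ≡.refl)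

-- Evaluation at roots of unity

module RootsOfUnity {c ℓ₁ ℓ₂} (K : HeytingField c ℓ₁ ℓ₂) where

  open HeytingField K using (_#_; #⇒invertible; heytingCommutativeRing)
  open HeytingCommutativeRing heytingCommutativeRing using (commutativeRing)
  open CommutativeRing commutativeRing hiding (zero)
  open import Algebra.Definitions.RawSemiring (Semiring.rawSemiring semiring) using (product)
  open import Algebra.Properties.Monoid.Mult +-monoid using (×-homo-+)
  open import Algebra.Properties.Monoid.Sum +-monoid using (sum-cong-≋)
  open import Algebra.Properties.Ring ring using (-0#≈0#; -1*x≈-x)
  open import Algebra.Properties.Semiring.Mult semiring using (×1-homo-*)
  open RootOfUnitySums K
  open SymmetricFunctions commutativeRing
  open WordSums K using (𝒴-list-monomial)
  import Algebra.Solver.Ring.NaturalCoefficients.Default commutativeSemiring as Solver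
  open Solver using (_:+_; _:*_; _:=_; con)
  open import Relation.Binary.Reasoning.Setoid setoid

  binomial-fromℕ : ∀ n k → binomial n k ≈ fromℕ (n C k)
  binomial-fromℕ zero    zero    = sym (+-identityʳ 1#)
  binomial-fromℕ zero    (suc k) = sym (reflexive (≡.cong fromℕ (k>n⇒nCk≡0 {0} {suc k} z<s)))
  binomial-fromℕ (suc n) zero    = trans (e-zero {suc n} (λ _ → 1#)) (sym (+-identityʳ 1#))
  binomial-fromℕ (suc n) (suc k) = begin
    binomial n (suc k) + 1# * binomial n k
      ≈⟨ +-cong (binomial-fromℕ n (suc k)) (trans (*-identityˡ _) (binomial-fromℕ n k)) ⟩
    fromℕ (n C suc k) + fromℕ (n C k)
      ≈⟨ +-comm _ _ ⟩
    fromℕ (n C k) + fromℕ (n C suc k)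
      ≈⟨ ×-homo-+ 1# (n C k) (n C suc k) ⟨
    fromℕ (n C k ℕ.+ n C suc k)
      ≡⟨ ≡.cong fromℕ (nCk+nC[k+1]≡[n+1]C[k+1] n k) ⟩
    fromℕ (suc n C suc k)  ∎

  binomial-sym : ∀ {n k} → k ≤ n → binomial n k ≈ binomial n (n ∸ k)
  binomial-sym {n} {k} k≤n = begin
    binomial n k             ≈⟨ binomial-fromℕ n k ⟩
    fromℕ (n C k)            ≡⟨ ≡.cong fromℕ (nCk≡nC[n∸k] k≤n) ⟩
    fromℕ (n C (n ∸ k))      ≈⟨ binomial-fromℕ n (n ∸ k) ⟨
    binomial n (n ∸ k)       ∎

  invertible-cancel : ∀ {a b u v} → a * b ≈ 1# → b * u ≈ b * v → u ≈ v
  invertible-cancel {a} {b} {u} {v} ab≈1 bu≈bv = begin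
    u            ≈⟨ trans (*-congʳ ab≈1) (*-identityˡ u) ⟨
    a * b * u    ≈⟨ *-assoc a b u ⟩
    a * (b * u)  ≈⟨ *-congˡ bu≈bv ⟩
    a * (b * v)  ≈⟨ *-assoc a b v ⟨
    a * b * v    ≈⟨ trans (*-congʳ ab≈1) (*-identityˡ v) ⟩
    v            ∎

  recipℕ-inverse : ∀ char0 k .⦃ _ : NonZero k ⦄ → recipℕ char0 k * fromℕ k ≈ 1#
  recipℕ-inverse char0 k = trans
    (*-congˡ (sym (trans (+-congˡ -0#≈0#) (+-identityʳ _))))
    (proj₁ (proj₂ (#⇒invertible (char0 k))))

  1-1≈0 : 1# + - 1# ≈ 0#
  1-1≈0 = -‿inverseʳ 1#

  module _ {N : ℕ} {ζ : Carrier} (prim : IsPrimitiveRoot (suc N) ζ) where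

    open IsPrimitiveRoot prim

    x y : Fin N → Carrier
    x = recip prim
    y i = 1# - ζ ^ suc (toℕ i)

    xy≈1 : ∀ i → x i * y i ≈ 1#
    xy≈1 i = proj₁ (proj₂ (#⇒invertible (1-apart-ζ^i z<s (s≤s (toℕ<n i)))))

    -- By `e-geometric` the value is unchanged under multiplication by ζᵏ, and 1 - ζᵏ is invertible
    -- in this range. The sign is chosen so that 1 plus a member of the family is 1 - ζⁱ.
    e-roots-vanishes : ∀ k → 0 < k → k < suc N → e {suc N} (λ i → - 1# * ζ ^ toℕ i) k ≈ 0#
    e-roots-vanishes k 0<k k<n = invertible-cancel (proj₁ (proj₂ inv)) (begin
      (1# - ζ ^ k) * E            ≈⟨ distribʳ E 1# (- ζ ^ k) ⟩
      1# * E + - ζ ^ k * E        ≈⟨ +-cong (*-identityˡ E) (*-congʳ (sym (-1*x≈-x (ζ ^ k)))) ⟩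
      E + - 1# * ζ ^ k * E        ≈⟨ +-congˡ (*-assoc _ _ _) ⟩
      E + - 1# * (ζ ^ k * E)      ≈⟨ +-congˡ (*-congˡ (e-geometric (suc N) ζ^n≈1 (- 1#) k)) ⟩
      E + - 1# * E                ≈⟨ +-congˡ (-1*x≈-x E) ⟩
      E + - E                     ≈⟨ -‿inverseʳ E ⟩
      0#                          ≈⟨ zeroʳ _ ⟨
      (1# - ζ ^ k) * 0#           ∎)
      where
      inv = #⇒invertible (1-apart-ζ^i 0<k k<n)
      E = e {suc N} (λ i → - 1# * ζ ^ toℕ i) k

    e-y : ∀ k → k ≤ N → e y k ≈ binomial (suc N) k
    e-y k k≤N = begin
      e y k
        ≈⟨ +-identityʳ _ ⟨
      e y k + 0#
        -- The extra member 1 - ζ⁰ = 0 changes no elementary symmetric function and completes the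
        -- family to all n roots.
        ≈⟨ +-cong (e-cong {u = λ i → 1# + v (suc i)} {v = y} (λ i → +-congˡ (-1*x≈-x _)) k)
                  (trans (*-congʳ (trans (+-congˡ (*-identityʳ (- 1#))) 1-1≈0)) (zeroˡ _)) ⟨
      e {suc N} (λ i → 1# + v i) k
        ≈⟨ e-1+ v k ⟩
      homogenise (suc N) (e v) k
        ≈⟨ homogenise-one (suc N) (e v) k (e-zero v)
             (λ j 0<j j≤k → e-roots-vanishes j 0<j (s≤s (ℕ.≤-trans j≤k k≤N))) ⟩
      binomial (suc N) k  ∎
      where
      v : Fin (suc N) → Carrier
      v i = - 1# * ζ ^ toℕ i

    product-y : product y ≈ fromℕ (suc N)
    product-y = begin
      product y                      ≈⟨ e-product y ⟨
      e y N                          ≈⟨ e-y N ℕ.≤-refl ⟩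
      binomial (suc N) N             ≈⟨ binomial-sym (ℕ.n≤1+n N) ⟩
      binomial (suc N) (suc N ∸ N)   ≡⟨ ≡.cong (binomial (suc N)) (ℕ.m+n∸n≡m 1 N) ⟩
      binomial (suc N) 1             ≈⟨ binomial-fromℕ (suc N) 1 ⟩
      fromℕ (suc N C 1)              ≡⟨ ≡.cong fromℕ (nC1≡n (suc N)) ⟩
      fromℕ (suc N)                  ∎

    product-xy : fromℕ (suc N) * product x ≈ 1#
    product-xy = begin
      fromℕ (suc N) * product x    ≈⟨ *-cong (sym product-y) (sym (e-product x)) ⟩
      product y * e x N            ≈⟨ e-reverse x y xy≈1 0 N ≡.refl ⟨
      e y 0                        ≈⟨ e-zero y ⟩
      1#                           ∎

    -- Reversal turns degree k for `x` into degree N - k for `y`. Beyond N both sides vanish; these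
    -- k occur too, since the convolution for e_m(x²) runs up to degree 2m.
    e-x : ∀ k → fromℕ (suc N) * e x k ≈ binomial (suc N) (suc k)
    e-x k with k ℕ.≤? N
    ... | yes k≤N = begin
      fromℕ (suc N) * e x k     ≈⟨ *-congʳ product-y ⟨
      product y * e x k         ≈⟨ e-reverse x y xy≈1 (N ∸ k) k (ℕ.m∸n+n≡m k≤N) ⟨
      e y (N ∸ k)               ≈⟨ e-y (N ∸ k) (ℕ.m∸n≤m N k) ⟩
      binomial (suc N) (N ∸ k)  ≈⟨ binomial-sym (s≤s k≤N) ⟨
      binomial (suc N) (suc k)  ∎
    ... | no k≰N = begin
      fromℕ (suc N) * e x k     ≈⟨ *-congˡ (e-vanishes x (ℕ.≰⇒> k≰N)) ⟩
      fromℕ (suc N) * 0#        ≈⟨ zeroʳ _ ⟩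
      0#                        ≈⟨ e-vanishes {suc N} (λ _ → 1#) (s≤s (ℕ.≰⇒> k≰N)) ⟨
      binomial (suc N) (suc k)  ∎

    e-x² : ∀ m → fromℕ (suc N ℕ.* suc m) * e (λ i → x i * x i) m
           ≈ fromℕ (N C m) + (- 1#) ^ m * fromℕ (N C (2 ℕ.* m ℕ.+ 1))
    e-x² m = invertible-cancel (trans (*-comm _ _) product-xy) (begin
      n * (fromℕ (suc N ℕ.* suc m) * E)
        ≈⟨ *-congˡ (*-congʳ (×1-homo-* (suc N) (suc m))) ⟩
      n * (n * M * E)
        ≈⟨ Solver.solve 3 (λ n M E → n :* (n :* M :* E) := M :* (n :* n :* E)) refl n M E ⟩
      M * (n * n * E)
        ≈⟨ *-congˡ (e-squares-binomial {suc N} 1-1≈0 x e-x m) ⟩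
      M * (b + A * (t + t))
        -- The two copies of `t` complete m + 1 to 2m + 2, the factor needed for absorption in that
        -- degree.
        ≈⟨ Solver.solve 4 (λ M b A t → M :* (b :+ A :* (t :+ t))
             := M :* b :+ A :* (M :* (con 1 :+ (con 1 :+ con 0)) :* t)) refl M b A t ⟩
      M * b + A * (M * fromℕ 2 * t)
        ≈⟨ +-congˡ (*-congˡ (*-congʳ (×1-homo-* (suc m) 2))) ⟨
      M * b + A * (fromℕ (suc m ℕ.* 2) * t)
        ≈⟨ +-cong (binomial-absorb N m) (*-congˡ (binomial-absorb N (suc (m ℕ.* 2)))) ⟩
      n * binomial N m + A * (n * binomial N (suc (m ℕ.* 2)))
        ≈⟨ Solver.solve 4 (λ n p A q → n :* p :+ A :* (n :* q) := n :* (p :+ A :* q))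
             refl n (binomial N m) A (binomial N (suc (m ℕ.* 2))) ⟩
      n * (binomial N m + A * binomial N (suc (m ℕ.* 2)))
        ≈⟨ *-congˡ (+-cong (binomial-fromℕ N m) (*-congˡ (binomial-fromℕ N (suc (m ℕ.* 2))))) ⟩
      n * (fromℕ (N C m) + A * fromℕ (N C suc (m ℕ.* 2)))
        ≡⟨ ≡.cong (λ k → n * (fromℕ (N C m) + A * fromℕ (N C k))) odd ⟩
      n * (fromℕ (N C m) + A * fromℕ (N C (2 ℕ.* m ℕ.+ 1)))  ∎)
      where
      n = fromℕ (suc N)
      M = fromℕ (suc m)
      E = e (λ i → x i * x i) m
      A = (- 1#) ^ m
      b = binomial (suc N) (suc m)
      t = binomial (suc N) (suc m ℕ.* 2)
      odd : suc (m ℕ.* 2) ≡ 2 ℕ.* m ℕ.+ 1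
      odd = ≡.trans (≡.cong suc (ℕ.*-comm m 2)) (ℕ.+-comm 1 (2 ℕ.* m))

    module _ {m ℓ : ℕ} (m≤N : m ≤ N) (ℓ≤m : ℓ ≤ m) where

      p : ℕ
      p = N ∸ m

      -- The terms with c exponents 1 and d exponents 0, in which b + d = ℓ.
      term : ℕ → ℕ → Carrier
      term c d = antidiagonal m (λ a b → δ ℓ (b ℕ.+ d) * monomial x a b c)

      term-monomial : ∀ {a b c d} → a ℕ.+ b ≡ m → d ℕ.+ b ≡ ℓ → term c d ≈ monomial x a b c
      term-monomial {a} {b} {c} {d} ≡.refl ≡.refl = trans
        (antidiagonal-cong (a ℕ.+ b) λ i j _ → *-congʳ (reflexive (δ-+ d b j)))
        (antidiagonal-δ a b (λ a b → monomial x a b c))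

      -- No b satisfies b + d = ℓ. This is the counterpart of the convention that a negative block
      -- length gives 0.
      term-vanishes : ∀ {c d} → ℓ < d → term c d ≈ 0#
      term-vanishes ℓ<d = antidiagonal-vanishes m λ a b _ → trans
        (*-congʳ (reflexive (δ-< (ℕ.≤-trans ℓ<d (ℕ.m≤n+m _ b))))) (zeroˡ _)

      length₂ : + m ℤ.- + ℓ ≡ + (m ∸ ℓ)
      length₂ = ≡.trans (ℤ.m-n≡m⊖n m ℓ) (ℤ.⊖-≥ ℓ≤m)

      -- The factor n ∏ xᵢ = 1 brings this term to the exponents and the coefficient n of the
      -- others; all variables then have positive exponents, so d = 0.
      first-term : 𝒴 prim (2 ^[ + m ℤ.- + ℓ ] ∷ 1 ^[ + ℓ ] ∷ []) ≈ fromℕ (suc N) * term p 0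
      first-term rewrite length₂ = begin
        𝒴-list prim (blocks 0 (m ∸ ℓ) ℓ)
          ≈⟨ 𝒴-list-monomial prim 0 (m ∸ ℓ) ℓ ⟩
        monomial x 0 (m ∸ ℓ) ℓ
          ≈⟨ trans (*-congʳ product-xy) (*-identityˡ _) ⟨
        fromℕ (suc N) * product x * monomial x 0 (m ∸ ℓ) ℓ
          ≈⟨ *-assoc _ _ _ ⟩
        fromℕ (suc N) * (product x * monomial x 0 (m ∸ ℓ) ℓ)
          ≈⟨ *-congˡ (monomial-shift x (m ∸ ℓ) ℓ p
               (≡.trans (≡.cong (ℕ._+ p) (ℕ.m∸n+n≡m ℓ≤m)) (ℕ.m+[n∸m]≡n m≤N))) ⟩
        fromℕ (suc N) * monomial x (m ∸ ℓ) ℓ p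
          ≈⟨ *-congˡ (term-monomial (ℕ.m∸n+n≡m ℓ≤m) ≡.refl) ⟨
        fromℕ (suc N) * term p 0  ∎

      minus-minus : ∀ i a b → i ℤ.- + a ℤ.- + b ≡ i ℤ.- + (a ℕ.+ b)
      minus-minus i a b = ≡.trans (ℤ.+-assoc i (ℤ.- + a) (ℤ.- + b))
        (≡.cong (ℤ._+_ i) (≡.sym (ℤ.neg-distrib-+ (+ a) (+ b))))

      length₃ : ∀ j → + m ℤ.- + ℓ ℤ.+ + 1 ℤ.+ + j ≡ + (m ∸ ℓ ℕ.+ 1 ℕ.+ j)
      length₃ j rewrite length₂ = ≡.refl

      length₁ : ∀ {j} → j < p → + suc N ℤ.- + m ℤ.- + 2 ℤ.- + j ≡ + (p ∸ suc j)
      length₁ {j} j<p = ≡.trans (≡.cong (ℤ._- + j) (minus-minus (+ suc N) m 2))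
        (≡.trans (minus-minus (+ suc N) (m ℕ.+ 2) j)
        (≡.trans (≡.cong (λ k → + suc N ℤ.- + k) rearrange)
        (≡.trans (ℤ.m-n≡m⊖n (suc N) (suc (m ℕ.+ suc j)))
        (≡.trans (ℤ.⊖-≥ (s≤s bound))
                 (≡.cong +_ (≡.sym (ℕ.∸-+-assoc N m (suc j))))))))
        where
        rearrange : m ℕ.+ 2 ℕ.+ j ≡ suc (m ℕ.+ suc j)
        rearrange = ≡.trans (ℕ.+-assoc m 2 j) (ℕ.+-suc m (suc j))
        bound : m ℕ.+ suc j ≤ N
        bound = ℕ.≤-trans (ℕ.+-monoʳ-≤ m j<p) (ℕ.≤-reflexive (ℕ.m+[n∸m]≡n m≤N))

      later-term : ∀ j → j < p →
        𝒴 prim ( 3 ^[ + m ℤ.- + ℓ ℤ.+ + 1 ℤ.+ + j ]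
               ∷ 2 ^[ + ℓ ℤ.- + 1 ℤ.- + j ]
               ∷ 1 ^[ + suc N ℤ.- + m ℤ.- + 2 ℤ.- + j ]
               ∷ []) ≈ term (p ∸ suc j) (suc j)
      later-term j j<p
        rewrite length₃ j | length₁ j<p | minus-minus (+ ℓ) 1 j | ℤ.m-n≡m⊖n ℓ (suc j)
        with suc j ℕ.≤? ℓ
      ... | yes j<ℓ rewrite ℤ.⊖-≥ j<ℓ = trans
        (𝒴-list-monomial prim (m ∸ ℓ ℕ.+ 1 ℕ.+ j) (ℓ ∸ suc j) (p ∸ suc j))
        (sym (term-monomial total (ℕ.m+[n∸m]≡n j<ℓ)))
        where
        total : m ∸ ℓ ℕ.+ 1 ℕ.+ j ℕ.+ (ℓ ∸ suc j) ≡ m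
        total = ≡.trans (≡.cong (ℕ._+ (ℓ ∸ suc j)) (ℕ.+-assoc (m ∸ ℓ) 1 j))
          (≡.trans (ℕ.+-assoc (m ∸ ℓ) (suc j) (ℓ ∸ suc j))
          (≡.trans (≡.cong (m ∸ ℓ ℕ.+_) (ℕ.m+[n∸m]≡n j<ℓ)) (ℕ.m∸n+n≡m ℓ≤m)))
      -- The last rewrite exposes a successor, so that the length of the block of 2s computes to
      -- `-[1+_]` and the left side to `0#`.
      ... | no j≮ℓ rewrite ℤ.⊖-< (ℕ.≰⇒> j≮ℓ) | ℕ.+-∸-assoc 1 (ℕ.≤-pred (ℕ.≰⇒> j≮ℓ)) =
        sym (term-vanishes (ℕ.≰⇒> j≮ℓ))

      𝒴-sum :
        𝒴 prim (2 ^[ + m ℤ.- + ℓ ] ∷ 1 ^[ + ℓ ] ∷ [])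
          + fromℕ (suc N) * (∑[ j < p ]
              𝒴 prim ( 3 ^[ + m ℤ.- + ℓ ℤ.+ + 1 ℤ.+ + toℕ j ]
                     ∷ 2 ^[ + ℓ ℤ.- + 1 ℤ.- + toℕ j ]
                     ∷ 1 ^[ + suc N ℤ.- + m ℤ.- + 2 ℤ.- + toℕ j ]
                     ∷ []))
        ≈ e (λ i → x i * x i) m * fromℕ (suc N C ℓ)
      𝒴-sum = begin
        _ + n * _
          ≈⟨ +-cong first-term (*-congˡ (sum-cong-≋ λ j → later-term (toℕ j) (toℕ<n j))) ⟩
        n * term p 0 + n * (∑[ j < p ] term (p ∸ suc (toℕ j)) (suc (toℕ j)))
          ≈⟨ distribˡ n _ _ ⟨
        n * (term p 0 + ∑[ j < p ] term (p ∸ suc (toℕ j)) (suc (toℕ j)))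
          -- The terms d = 0 and d = j + 1 together fill the whole antidiagonal c + d = p.
          ≈⟨ *-congˡ (antidiagonal-sum p term) ⟨
        n * sumOfMonomials x m p (δ ℓ)
          ≈⟨ *-congˡ (sumOfMonomials-factors x y xy≈1 m p (δ ℓ) (ℕ.m+[n∸m]≡n m≤N)) ⟩
        n * (product x * (E * evaluate y (δ ℓ)))
          ≈⟨ *-assoc n (product x) _ ⟨
        n * product x * (E * evaluate y (δ ℓ))
          ≈⟨ trans (*-congʳ product-xy) (*-identityˡ _) ⟩
        E * evaluate y (δ ℓ)
          ≈⟨ *-congˡ (trans (evaluate-δ y ℓ) (trans (e-y ℓ (ℕ.≤-trans ℓ≤m m≤N)) (binomial-fromℕ (suc N) ℓ))) ⟩
        E * fromℕ (suc N C ℓ)  ∎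
        where
        n = fromℕ (suc N)
        E = e (λ i → x i * x i) m

theorem3 : ∀ {c ℓ₁ ℓ₂} (K : HeytingField c ℓ₁ ℓ₂) →
    let open HeytingField K
        open RootOfUnitySums K
    in
    (char0 : CharacteristicZero) →
    (n m ℓ : ℕ) .⦃ _ : NonZero n ⦄ →
    m ≤ n ∸ 1 → ℓ ≤ m →
    (ζ : Carrier) (prim : IsPrimitiveRoot n ζ) →
    𝒴 prim (2 ^[ + m ℤ.- + ℓ ] ∷ 1 ^[ + ℓ ] ∷ [])
      + fromℕ n * (∑[ j < n ∸ 1 ∸ m ]
          𝒴 prim ( 3 ^[ + m ℤ.- + ℓ ℤ.+ + 1 ℤ.+ + toℕ j ]
                 ∷ 2 ^[ + ℓ ℤ.- + 1 ℤ.- + toℕ j ]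
                 ∷ 1 ^[ + n ℤ.- + m ℤ.- + 2 ℤ.- + toℕ j ]
                 ∷ []))
    ≈ recipℕ char0 (n ℕ.* suc m) ⦃ m*n≢0 n (suc m) ⦄
      * (fromℕ ((n ∸ 1) C m) + (- 1#) ^ m * fromℕ ((n ∸ 1) C (2 ℕ.* m ℕ.+ 1)))
      * fromℕ (n C ℓ)
theorem3 K char0 (suc N) m ℓ m≤N ℓ≤m ζ prim = trans (𝒴-sum prim m≤N ℓ≤m) (*-congʳ (begin
  E                   ≈⟨ trans (*-congʳ (recipℕ-inverse char0 (suc N ℕ.* suc m))) (*-identityˡ E) ⟨
  r * D * E           ≈⟨ *-assoc r D E ⟩
  r * (D * E)         ≈⟨ *-congˡ (e-x² prim m) ⟩
  r * (fromℕ (N C m) + (- 1#) ^ m * fromℕ (N C (2 ℕ.* m ℕ.+ 1)))  ∎))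
  where
  open HeytingCommutativeRing (HeytingField.heytingCommutativeRing K) using (commutativeRing)
  open CommutativeRing commutativeRing
  open import Relation.Binary.Reasoning.Setoid setoid
  open RootOfUnitySums K
  open RootsOfUnity K
  open SymmetricFunctions commutativeRing using (e)
  r = recipℕ char0 (suc N ℕ.* suc m)
  D = fromℕ (suc N ℕ.* suc m)
  E = e (λ i → x prim i * x prim i) m
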